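{- Let $G$ be a chordal graph satisfying one of the following: (a) $G$ has an $H$-appendix; (b) $G$ has an isolated edge, i.e., a connected component consisting of a single edge; (c) $G$ has a simplicial vertex $y$ such that $G-y$ satisfies (a), satisfies (b), or is a 2-connected chordal graph. Then the vertices of $G$ can be labeled $1,\ldots,n$ such that this ordering is a perfect elimination ordering and the following holds. In the sequence of elimination forests visited by Algorithm R started at $F_0$ (removal of vertices in order $1,\ldots,n$), the first and last forests differ by a single tree rotation.
   Context: A vertex is simplicial if it forms a clique together with all its neighbors. A graph is 2-connected if it has at least three vertices and removing any one vertex leaves it connected. Let $H$ be a 2-connected graph with a vertex $x$ such that $H-x$ is 2-connected or a single edge. A graph $G$ has an $H$-appendix if $G$ is obtained from an arbitrary (not necessarily connected) graph $H'$ with at least two vertices by gluing $H$ onto $H'$, identifying the vertex $x$ of $H$ with one vertex of $H'$; "has an $H$-appendix" means this holds for some such $H$. A perfect elimination ordering of $G=([n],E)$ is an ordering $1,\ldots,n$ in which each vertex $v$ forms a clique with its neighbors smaller than $v$. An elimination tree for a connected graph $G$ is a rooted tree on its vertex set consisting of a root $x$ whose children are the roots of elimination trees for the components of $G-x$ (unordered). An elimination forest is one tree per component. A vertex removal order determines an elimination forest. Rotation of a tree edge $\{i,j\}$, where $i$ is the parent of $j$: let $H$ be the subgraph induced by the subtree rooted at $i$. Then $j$ takes $i$'s place, $i$ becomes a child of $j$, subtrees of $i$ stay with $i$, and each subtree $S$ of $j$ stays with $j$ unless $S$ lies in the same component of $H-j$ as $i$, in which case it moves to $i$. Up-rotation of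 $j$: rotate the edge to its parent $i<j$. Down-rotation of $j$: rotate an edge to a child $i<j$. Algorithm R: visit $F_0$. Then repeatedly, in the last visited forest, take the largest vertex $j$ admitting an up- or down-rotation to an unvisited forest. Terminate if none exists, or if more than one edge $\{i,j\}$ with $i<j$ leads to an unvisited forest. Otherwise perform the rotation and visit. -}

module Defs where

open import Data.Nat using (ℕ; zero; suc; _≤_)
open import Data.Fin using (Fin; toℕ) renaming (_<_ to _<ᶠ_; _≤_ to _≤ᶠ_)
open import Data.Fin.Permutation using (Permutation′; _⟨$⟩ʳ_)
open import Data.Bool using (Bool; true; false)
open import Data.Maybe using (Maybe; just; nothing)
open import Data.Vec using (Vec; lookup)
open import Data.List using (List; []; _∷_)
open import Data.List.Membership.Propositional using (_∉_)
open import Data.Product using (Σ; _×_; _,_; ∃; ∃-syntax)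
open import Data.Sum using (_⊎_)
open import Data.Empty using (⊥)
open import Relation.Nullary using (¬_)
open import Relation.Binary.PropositionalEquality using (_≡_; _≢_)
open import Function.Definitions using (Injective)
open import Function.Bundles using (_⇔_)
open import Level using (Lift)
import Level

record Graph (n : ℕ) : Set where
  field
    E      : Fin n → Fin n → Bool
    sym    : ∀ u v → E u v ≡ E v u
    irrefl : ∀ v → E v v ≡ false
open Graph public

Adj : ∀ {n} → Graph n → Fin n → Fin n → Set
Adj G u v = E G u v ≡ true

-- Vertex subsets (the vertex set of an induced subgraph G[W])
VSet : ℕ → Set₁
VSet n = Fin n → Set

All : ∀ {n} → VSet n
All _ = Data.Unit.⊤
  where import Data.Unit

_∖₁_ : ∀ {n} → VSet n → Fin n → VSet n
(W ∖₁ y) v = W v × v ≢ y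

data Reach {n} (G : Graph n) (W : VSet n) : Fin n → Fin n → Set where
  here : ∀ {u} → W u → Reach G W u u
  step : ∀ {u v w} → W u → Adj G u v → Reach G W v w → Reach G W u w

ConnectedIn : ∀ {n} → Graph n → VSet n → Set
ConnectedIn G W = ∀ u v → W u → W v → Reach G W u v

TwoConnectedIn : ∀ {n} → Graph n → VSet n → Set
TwoConnectedIn G W =
  (Σ (Fin _) λ a → Σ (Fin _) λ b → Σ (Fin _) λ c →
     W a × W b × W c × a ≢ b × b ≢ c × a ≢ c)
  × (∀ x → W x → ConnectedIn G (W ∖₁ x))

SingleEdgeIn : ∀ {n} → Graph n → VSet n → Set
SingleEdgeIn G W = Σ (Fin _) λ a → Σ (Fin _) λ b →
  a ≢ b × Adj G a b × (∀ v → W v ⇔ (v ≡ a ⊎ v ≡ b))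

Consec : (k : ℕ) → Fin k → Fin k → Set
Consec k i j = (suc (toℕ i) ≡ toℕ j) ⊎ (suc (toℕ i) ≡ k × toℕ j ≡ 0)

IsCycleIn : ∀ {n} → Graph n → VSet n → (k : ℕ) → (Fin k → Fin n) → Set
IsCycleIn G W k c = Injective _≡_ _≡_ c × (∀ i → W (c i))
                    × (∀ i j → Consec k i j → Adj G (c i) (c j))

ChordalIn : ∀ {n} → Graph n → VSet n → Set
ChordalIn G W = ∀ k → 4 ≤ k → (c : Fin k → Fin _) → IsCycleIn G W k c →
  Σ (Fin k) λ i → Σ (Fin k) λ j →
    i ≢ j × ¬ Consec k i j × ¬ Consec k j i × Adj G (c i) (c j)

Chordal : ∀ {n} → Graph n → Set
Chordal G = ChordalIn G All

SimplicialIn : ∀ {n} → Graph n → VSet n → Fin n → Set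
SimplicialIn G W v = ∀ u w → W u → W w → Adj G v u → Adj G v w → u ≢ w → Adj G u w

-- G[W] has an H-appendix: G[W] is obtained by gluing H = G[X] onto
-- H' = G[(W ∖ X) ∪ {x}] at the vertex x, where H is 2-connected,
-- H - x is 2-connected or a single edge, H' has at least two vertices,
-- and there are no edges between X ∖ {x} and W ∖ X.
HAppendixIn : ∀ {n} → Graph n → VSet n → Set₁
HAppendixIn {n} G W = Σ (VSet n) λ X → Σ (Fin n) λ x →
    (∀ v → X v → W v) × X x
  × TwoConnectedIn G X
  × (TwoConnectedIn G (X ∖₁ x) ⊎ SingleEdgeIn G (X ∖₁ x))
  × (Σ (Fin n) λ v → W v × ¬ X v)
  × (∀ u v → X u → u ≢ x → W v → ¬ X v → ¬ Adj G u v)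

IsolatedEdgeIn : ∀ {n} → Graph n → VSet n → Set
IsolatedEdgeIn G W = Σ (Fin _) λ a → Σ (Fin _) λ b →
  W a × W b × Adj G a b
  × (∀ v → W v → Adj G a v → v ≡ b) × (∀ v → W v → Adj G b v → v ≡ a)

CondABIn : ∀ {n} → Graph n → VSet n → Set₁
CondABIn G W = HAppendixIn G W ⊎ Lift (Level.suc Level.zero) (IsolatedEdgeIn G W)

CondC : ∀ {n} → Graph n → Set₁
CondC {n} G = Σ (Fin n) λ y → SimplicialIn G All y ×
  (CondABIn G (All ∖₁ y)
   ⊎ Lift (Level.suc Level.zero) (TwoConnectedIn G (All ∖₁ y) × ChordalIn G (All ∖₁ y)))

relabel : ∀ {n} → Graph n → Permutation′ n → Graph n
relabel {n} G π = record
  { E = λ i j → E G (π ⟨$⟩ʳ i) (π ⟨$⟩ʳ j)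
  ; sym = λ i j → sym G (π ⟨$⟩ʳ i) (π ⟨$⟩ʳ j)
  ; irrefl = λ i → irrefl G (π ⟨$⟩ʳ i) }

IsPEO : ∀ {n} → Graph n → Set
IsPEO G = ∀ v u w → u <ᶠ v → w <ᶠ v → Adj G v u → Adj G v w → u ≢ w → Adj G u w

-- Rooted forests on Fin n as parent vectors (nothing = root)

Forest : ℕ → Set
Forest n = Vec (Maybe (Fin n)) n

data Desc {n} (F : Forest n) (r : Fin n) : Fin n → Set where
  self  : Desc F r r
  below : ∀ {u v} → lookup F v ≡ just u → Desc F r u → Desc F r v

-- The elimination forest F₀ of the removal order 1,…,n: the parent of v
-- is the last removed vertex u < v such that, at the time u is removed,
-- v is in u's component, i.e. u and v are connected in G[{w | w ≥ u}].
ParentF0 : ∀ {n} → Graph n → Fin n → Fin n → Set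
ParentF0 G v u = u <ᶠ v × Reach G (u ≤ᶠ_) u v
  × (∀ u' → u' <ᶠ v → Reach G (u' ≤ᶠ_) u' v → u' ≤ᶠ u)

IsF0 : ∀ {n} → Graph n → Forest n → Set
IsF0 G F = ∀ v u → (lookup F v ≡ just u) ⇔ ParentF0 G v u

Rot : ∀ {n} → Graph n → Forest n → Fin n → Fin n → Forest n → Set
Rot G F i j F' =
    lookup F j ≡ just i
  × lookup F' j ≡ lookup F i
  × lookup F' i ≡ just j
  × (∀ v → v ≢ i → v ≢ j → lookup F v ≢ just j → lookup F' v ≡ lookup F v)
  × (∀ c → lookup F c ≡ just j → c ≢ i →
        (SameComp c → lookup F' c ≡ just i)
      × (¬ SameComp c → lookup F' c ≡ just j))
  where
    HminusJ = λ v → Desc F i v × v ≢ j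
    SameComp = λ c → ∀ s → Desc F c s → Reach G HminusJ i s

Good : ∀ {n} → Graph n → List (Forest n) → Forest n → Fin n → Fin n → Forest n → Set
Good G Vis F j i F' = i <ᶠ j × (Rot G F i j F' ⊎ Rot G F j i F') × F' ∉ Vis

Step : ∀ {n} → Graph n → List (Forest n) → Forest n → Forest n → Set
Step {n} G Vis F F' = Σ (Fin n) λ j → Σ (Fin n) λ i →
    Good G Vis F j i F'
  × (∀ j' i' F'' → Good G Vis F j' i' F'' → j' ≤ᶠ j)
  × (∀ i' F'' → Good G Vis F j i' F'' → i' ≡ i)

Terminal : ∀ {n} → Graph n → List (Forest n) → Forest n → Set
Terminal {n} G Vis F =
    (∀ j i F' → ¬ Good G Vis F j i F')
  ⊎ (Σ (Fin n) λ j → Σ (Fin n) λ i₁ → Σ (Fin n) λ i₂ →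
     Σ (Forest n) λ F₁ → Σ (Forest n) λ F₂ →
       i₁ ≢ i₂ × Good G Vis F j i₁ F₁ × Good G Vis F j i₂ F₂
     × (∀ j' i' F'' → Good G Vis F j' i' F'' → j' ≤ᶠ j))

data Trace {n} (G : Graph n) : Forest n → Forest n → List (Forest n) → Set where
  start : ∀ {F₀} → IsF0 G F₀ → Trace G F₀ F₀ (F₀ ∷ [])
  next  : ∀ {F₀ F F' Vis} → Trace G F₀ F Vis → Step G Vis F F' →
          Trace G F₀ F' (F' ∷ Vis)

Run : ∀ {n} → Graph n → Forest n → Forest n → Set
Run G F₀ F = Σ _ λ Vis → Trace G F₀ F Vis × Terminal G Vis F

Hyp : ∀ {n} → Graph n → Set₁
Hyp G = CondABIn G All ⊎ CondC G

{-# OPTIONS --safe #-}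
-- An elimination forest is determined by its sets of descendants, and a rotation changes only
-- the sets of its two vertices. If the last vertex k of a perfect elimination ordering is
-- deleted from an elimination forest, one obtains an elimination forest of G - k; the forests
-- over a given one differ only in the number of ancestors of k, so they form a path whose ends
-- have k as a root and as a leaf, and whose steps are the rotations at k. Algorithm R therefore
-- follows its own run on G - k, sweeping alternately up and down through these paths. If every
-- proper prefix graph on at least two vertices has an even number of elimination forests, all
-- later vertices end as leaves, and the last forest is obtained from the first by rotating the
-- edge {1, 2}.
--
-- The numbers are even by a fixed-point-free involution: in the appendix H without x (or in the
-- isolated edge, or the 2-connected graph itself) exchange the labels of the first two removed
-- vertices. By Dirac's theorem there is a perfect elimination ordering starting with H, whose
-- prefixes of size at least two inside H are 2-connected or a single edge.
module Submission where

open import Defs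
open import Data.Bool using (Bool; true; false; not)
open import Data.Bool.Properties using (not-involutive) renaming (_≟_ to _≟ᵇ_)
open import Data.Empty using (⊥; ⊥-elim)
open import Data.Fin using (Fin; zero; suc; toℕ; fromℕ; fromℕ<; opposite; _≟_) renaming (_<_ to _<ᶠ_; _≤_ to _≤ᶠ_)
open import Data.Fin.Permutation using (Permutation; Permutation′; permutation; _⟨$⟩ʳ_; _⟨$⟩ˡ_; inverseˡ; inverseʳ; ↔⇒≡)
open import Data.Fin.Properties using (any?; all?; ¬∀⟶∃¬; toℕ-injective; toℕ-fromℕ; toℕ-fromℕ<; toℕ<n; <-cmp; opposite-prop; opposite-involutive)
open import Data.Fin.Subset using (Subset; _∈_; ∣_∣)
open import Data.Fin.Subset.Properties using (p⊂q⇒∣p∣<∣q∣)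
open import Data.List using (List; []; _∷_; allFin; length) renaming (lookup to lookupᴸ)
open import Data.List.Membership.Propositional using () renaming (_∈_ to _∈ˡ_)
open import Data.List.Membership.Propositional.Properties using (∈-allFin; ∈-lookup)
open import Data.List.Properties using (length-removeAt′)
open import Data.List.Relation.Unary.All using (_∷_; []) renaming (All to Allᴸ; lookup to lookupᴬ)
open import Data.List.Relation.Unary.All.Properties using (─⁺; ¬Any⇒All¬)
open import Data.List.Relation.Unary.Any using (here; there; _─_; index)
open import Data.List.Relation.Unary.Unique.Propositional using (Unique; _∷_; [])
open import Data.Maybe using (Maybe; just; nothing)
open import Data.Maybe.Properties using () renaming (≡-dec to maybe-≡-dec)
open import Data.Nat using (ℕ; zero; suc; _+_; _∸_; s≤s; z≤n) renaming (_≤_ to _≤ⁿ_; _<_ to _<ⁿ_)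
import Data.Nat.Properties as ℕ
open import Data.Product using (Σ; _×_; _,_; proj₁; proj₂; ∃)
open import Data.Sum using (_⊎_; inj₁; inj₂; [_,_]; swap)
open import Data.Vec using (Vec; []; _∷_; lookup; tabulate; replicate)
open import Data.Vec.Properties using (lookup∘tabulate; []=⇒lookup; lookup⇒[]=; tabulate∘lookup; tabulate-cong; lookup-replicate)
open import Function using (_∘_; id; case_of_)
open import Function.Bundles using (mk⇔; Equivalence)
open import Level using (lift)
open import Relation.Binary.Definitions using (tri<; tri≈; tri>)
open import Relation.Binary.PropositionalEquality using (_≡_; _≢_; refl; trans; cong; subst; subst₂) renaming (sym to ≡-sym)
open import Relation.Nullary using (¬_; Dec; yes; no; does)
open import Relation.Nullary.Decidable using (_×-dec_; _→-dec_; _⊎-dec_; ¬?; map′; dec-true; dec-false; does-⇔; decidable-stable)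

-- Every prefix graph is kept on all `n` vertices, with the later ones isolated. Forests of all
-- prefixes thus share one type, and deleting `k` only deletes edges: `k` stays as a one-vertex
-- tree. The edge {1, 2} moves because of the one odd count: the prefix of size one has a single
-- elimination forest, so vertex 2 sweeps once and stops as a root. Each later vertex is inserted
-- over an even count and returns to a leaf, and a leaf takes no part in the rotation inherited from
-- below. Only proper prefixes are counted, which is why the simplicial vertex `y` of case (c) is
-- placed last. Exchanging the first two removed vertices `r`, `t` of `H - x` uses both
-- 2-connectivity conditions. Since `H - x` and `H - x - r` are connected, all other vertices of
-- `H - x` lie below `r` and `t`. Since `H` and `H - r` are connected, `x` is comparable with both,
-- so edges still join comparable vertices. A subtree containing `t` but not `r` receives `r` in
-- place of `t`, and stays connected because `H - x - t` and `H - t` are.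

private variable
  n m : ℕ
  G G' H : Graph n
  W W' : VSet n
  u v w i j k a b c : Fin n
  ℓ : List (Fin n)
  F F' F₀ F₁ F₂ F* : Forest n
  Vis Vis' Vis* : List (Forest n)

-- Walks inside a vertex set

Adj-sym : (G : Graph n) → Adj G u v → Adj G v u
Adj-sym {u = u} {v} G a = trans (≡-sym (sym G u v)) a

Adj⇒≢ : (G : Graph n) → Adj G u v → u ≢ v
Adj⇒≢ {u = u} G a refl with trans (≡-sym a) (irrefl G u)
... | ()

adj? : (G : Graph n) → ∀ u v → Dec (Adj G u v)
adj? G u v = E G u v ≟ᵇ true

reach-source : Reach G W u v → W u
reach-source (here w)     = w
reach-source (step w _ _) = w

reach-target : Reach G W u v → W v
reach-target (here w)     = w
reach-target (step _ _ r) = reach-target r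

reach-map : (∀ {a b} → Adj G a b → W a → W b → Adj G' a b) → (∀ {a} → W a → W' a) →
            Reach G W u v → Reach G' W' u v
reach-map f g (here w)     = here (g w)
reach-map f g (step w a r) = step (g w) (f a w (reach-source r)) (reach-map f g r)

reach-mono : (∀ {a} → W a → W' a) → Reach G W u v → Reach G W' u v
reach-mono = reach-map (λ a _ _ → a)

reach-trans : Reach G W u v → Reach G W v w → Reach G W u w
reach-trans (here _)     s = s
reach-trans (step x a r) s = step x a (reach-trans r s)

reach-snoc : Reach G W u v → Adj G v w → W w → Reach G W u w
reach-snoc r a w = reach-trans r (step (reach-target r) a (here w))

reach-sym : Reach G W u v → Reach G W v u
reach-sym (here w)             = here w
reach-sym {G = G} (step w a r) = reach-snoc (reach-sym r) (Adj-sym G a) w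

reach-closed : (P : VSet n) → P u → (∀ {a b} → P a → W a → W b → Adj G a b → P b) → Reach G W u v → P v
reach-closed P p f (here _)     = p
reach-closed P p f (step w a r) = reach-closed P (f p w (reach-source r) a) f r

reach-within : Reach G W u v → Reach G (Reach G W u) u v
reach-within (here w)     = here (here w)
reach-within (step w a r) = step (here w) a (reach-mono (step w a) (reach-within r))

-- A simplicial vertex k can be bypassed: its two neighbours on a walk are adjacent (or equal).
reach-avoid : (k : Fin n) →
  (∀ {a b} → W a → W b → Adj G k a → Adj G k b → a ≢ b → Adj G a b) →
  Reach G W u v → u ≢ k → v ≢ k → Reach G (W ∖₁ k) u v
reach-avoid {W = W} {G = G} k simp r u≢k v≢k = proj₁ (go r v≢k) u≢k
  where
  go : ∀ {u v} → Reach G W u v → v ≢ k →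
       (u ≢ k → Reach G (W ∖₁ k) u v)
       × (u ≡ k → ∀ {p} → W p → p ≢ k → Adj G p k → Reach G (W ∖₁ k) p v)
  go (here w) v≢k = (λ u≢k → here (w , u≢k)) , λ u≡k → ⊥-elim (v≢k u≡k)
  go (step {v = b} w a r) v≢k with go r v≢k | b ≟ k
  ... | _ , g | yes b≡k =
        (λ u≢k → g b≡k w u≢k (subst (Adj G _) b≡k a))
      , (λ { refl → ⊥-elim (Adj⇒≢ G a (≡-sym b≡k)) })
  ... | f , _ | no b≢k = (λ u≢k → step (w , u≢k) a (f b≢k)) , bypass
    where
    bypass : _ ≡ k → ∀ {p} → W p → p ≢ k → Adj G p k → Reach G (W ∖₁ k) p _
    bypass refl {p} wp p≢k ap with p ≟ b
    ... | yes refl = f b≢k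
    ... | no p≢b = step (wp , p≢k) (simp wp (reach-source r) (Adj-sym G ap) a p≢b) (f b≢k)

-- Finite vertex sets and decidable reachability

module _ {P : VSet n} (P? : ∀ v → Dec (P v)) where

  subset : Subset n
  subset = tabulate (does ∘ P?)

  ∈-subset⁺ : P v → v ∈ subset
  ∈-subset⁺ {v} p = lookup⇒[]= v _ (trans (lookup∘tabulate _ v) (dec-true (P? v) p))

  ∈-subset⁻ : v ∈ subset → P v
  ∈-subset⁻ {v} v∈ with P? v | trans (≡-sym (lookup∘tabulate (does ∘ P?) v)) ([]=⇒lookup v∈)
  ... | yes p | _ = p

-- Source of the decreasing measures: vertex sets are predicates, so recursion over them runs on a
-- bound for the number of their members.
subset-< : {P Q : VSet n} (P? : ∀ v → Dec (P v)) (Q? : ∀ v → Dec (Q v)) →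
           (∀ {v} → P v → Q v) → Q u → ¬ P u → ∣ subset P? ∣ <ⁿ ∣ subset Q? ∣
subset-< {u = u} P? Q? P⊆Q Qu ¬Pu = p⊂q⇒∣p∣<∣q∣
  ((λ v∈ → ∈-subset⁺ Q? (P⊆Q (∈-subset⁻ P? v∈))) , u , ∈-subset⁺ Q? Qu , ¬Pu ∘ ∈-subset⁻ P?)

∖? : (∀ v → Dec (W v)) → ∀ y v → Dec ((W ∖₁ y) v)
∖? W? y v = W? v ×-dec ¬? (v ≟ y)

-- Cut the walk at its last visit to `u`. The rest avoids `u`, so a search may delete the source
-- before it continues, and it terminates.
reach-first : Reach G W u v → u ≢ v → ∃ λ z → Adj G u z × Reach G (W ∖₁ u) z v
reach-first {G = G} {W = W} {u = u} r u≢v = [ (λ s → ⊥-elim (proj₂ (reach-source s) refl)) , id ] (go r (u≢v ∘ ≡-sym))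
  where
  go : ∀ {a v} → Reach G W a v → v ≢ u →
       Reach G (W ∖₁ u) a v ⊎ (∃ λ z → Adj G u z × Reach G (W ∖₁ u) z v)
  go (here w) v≢u = inj₁ (here (w , v≢u))
  go (step {u = a} w e r) v≢u with go r v≢u | a ≟ u
  ... | inj₂ q | _        = inj₂ q
  ... | inj₁ s | yes refl = inj₂ (_ , e , s)
  ... | inj₁ s | no a≢u   = inj₁ (step (w , a≢u) e s)

reach? : (G : Graph n) → (∀ v → Dec (W v)) → ∀ u v → Dec (Reach G W u v)
reach? {n} G W? u v = go _ W? ℕ.≤-refl u v
  where
  go : ∀ m {W : VSet n} (W? : ∀ v → Dec (W v)) → ∣ subset W? ∣ ≤ⁿ m → ∀ u v → Dec (Reach G W u v)
  go m W? le u v with W? u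
  ... | no ¬w = no (¬w ∘ reach-source)
  ... | yes w with u ≟ v
  ...   | yes refl = yes (here w)
  go zero W? le u v | yes w | no u≢v =
    ⊥-elim (ℕ.n≮0 (ℕ.<-≤-trans (subset-< (λ _ → no λ ()) W? ⊥-elim w id) le))
  go (suc m) W? le u v | yes w | no u≢v =
    map′ (λ (z , a , r) → step w a (reach-mono proj₁ r)) (λ r → reach-first r u≢v)
      (any? λ z → adj? G u z ×-dec
        go m (∖? W? u) (ℕ.≤-pred (ℕ.≤-trans (subset-< (∖? W? u) W? proj₁ w (λ q → proj₂ q refl)) le)) z v)

-- Rooted forests

-- A parent vector may contain cycles. An inductive path to a root excludes them and permits
-- recursion along ancestors.
data Rooted (F : Forest n) : Fin n → Set where
  root  : lookup F v ≡ nothing → Rooted F v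
  child : lookup F v ≡ just u → Rooted F u → Rooted F v

just-unique : {A : Set} {m : Maybe A} {a b : A} → m ≡ just a → m ≡ just b → a ≡ b
just-unique refl refl = refl

nothing≢just : {A : Set} {m : Maybe A} {a : A} → m ≡ nothing → m ≢ just a
nothing≢just refl ()

desc-trans : Desc F u v → Desc F v w → Desc F u w
desc-trans d self        = d
desc-trans d (below e q) = below e (desc-trans d q)

desc-chain : Desc F u w → Desc F v w → Desc F u v ⊎ Desc F v u
desc-chain self        q            = inj₂ q
desc-chain p           self         = inj₁ p
desc-chain (below e p) (below e' q) with just-unique e e'
... | refl = desc-chain p q

parent-desc : lookup F v ≡ just u → Desc F u v
parent-desc e = below e self

acyclic : Rooted F v → lookup F v ≡ just u → ¬ Desc F v u
acyclic (root x) e d = nothing≢just x e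
acyclic (child x r) e d with just-unique x e
acyclic (child x r) e self         | refl = acyclic r e self
acyclic (child x r) e (below e' d) | refl = acyclic r e' (desc-trans (parent-desc e) d)

desc? : Rooted F v → ∀ u → Dec (Desc F u v)
desc? {v = v} r u with u ≟ v
... | yes refl = yes self
desc? (root x)    u | no u≢v = no λ { self → u≢v refl ; (below e _) → nothing≢just x e }
desc? (child x r) u | no u≢v with desc? r u
... | yes d = yes (below x d)
... | no ¬d = no λ { self → u≢v refl ; (below e d) → ¬d (subst (Desc _ u) (just-unique e x) d) }

desc-antisym : (∀ v → Rooted F v) → Desc F u v → Desc F v u → u ≡ v
desc-antisym R self        _ = refl
desc-antisym R (below e d) q = ⊥-elim (acyclic (R _) e (desc-trans q d))

-- The deepest strict ancestor, expressed by the order alone. Through it, forests are compared and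
-- built via their descendant relations.
IsParent : (Fin n → Fin n → Set) → Fin n → Fin n → Set
IsParent D v u = D u v × u ≢ v × (∀ w → D w v → w ≢ v → D w u)

parent⁺ : (∀ v → Rooted F v) → lookup F v ≡ just u → IsParent (Desc F) v u
parent⁺ {F = F} {v} {u} R e = parent-desc e , (λ { refl → acyclic (R v) e self }) , up
  where
  up : ∀ w → Desc F w v → w ≢ v → Desc F w u
  up w self         w≢v = ⊥-elim (w≢v refl)
  up w (below e' d) _   = subst (Desc F w) (just-unique e' e) d

parent⁻ : (∀ v → Rooted F v) → IsParent (Desc F) v u → lookup F v ≡ just u
parent⁻ R (self , u≢v , _)        = ⊥-elim (u≢v refl)
parent⁻ R (below e d , u≢v , max) with parent⁺ R e
... | dp , p≢v , _ = trans e (cong just (desc-antisym R (max _ dp p≢v) d))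

forest-≡ : (∀ v u → lookup F v ≡ just u → lookup F' v ≡ just u) →
           (∀ v u → lookup F' v ≡ just u → lookup F v ≡ just u) → F ≡ F'
forest-≡ {F = F} {F'} f g =
  trans (≡-sym (tabulate∘lookup F)) (trans (tabulate-cong eq) (tabulate∘lookup F'))
  where
  eq : ∀ v → lookup F v ≡ lookup F' v
  eq v with lookup F v in e | lookup F' v in e'
  ... | nothing | nothing = refl
  ... | just u  | m       = trans (≡-sym (f v u e)) e'
  ... | nothing | just u  with trans (≡-sym (g v u e')) e
  ...   | ()

parent-transport : {D D' : Fin n → Fin n → Set} → (∀ {u v} → D u v → D' u v) → (∀ {u v} → D' u v → D u v) →
                   IsParent D v u → IsParent D' v u
parent-transport f g (d , u≢v , m) = f d , u≢v , λ w d' w≢v → f (m w (g d') w≢v)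

desc-ext : (∀ v → Rooted F v) → (∀ v → Rooted F' v) →
           (∀ {u v} → Desc F u v → Desc F' u v) → (∀ {u v} → Desc F' u v → Desc F u v) → F ≡ F'
desc-ext R R' f g = forest-≡
  (λ v u e → parent⁻ R' (parent-transport f g (parent⁺ R e)))
  (λ v u e → parent⁻ R (parent-transport g f (parent⁺ R' e)))

-- Elimination forests as tree orders

-- Instead of recursive removal: `conn` makes every subtree connected and `comp` forbids edges
-- between different branches, so the subtrees at the children of `u` are the components left when
-- `u` is removed from its subtree.
record EF (G : Graph n) (F : Forest n) : Set where
  field
    rooted : ∀ v → Rooted F v
    comp   : ∀ {u v} → Adj G u v → Desc F u v ⊎ Desc F v u
    conn   : ∀ {u v} → Desc F u v → Reach G (Desc F u) u v

  dec : ∀ u v → Dec (Desc F u v)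
  dec u v = desc? (rooted v) u

  antisym : Desc F u v → Desc F v u → u ≡ v
  antisym = desc-antisym rooted

  parent⇒≢ : lookup F v ≡ just u → u ≢ v
  parent⇒≢ e = proj₁ (proj₂ (parent⁺ rooted e))

  above-parent : lookup F v ≡ just u → Desc F w v → w ≢ v → Desc F w u
  above-parent e d ne = proj₂ (proj₂ (parent⁺ rooted e)) _ d ne

-- The conditions of `EF` on an arbitrary decidable tree order. The deletion, insertion, rotation
-- and exchange constructions only describe such an order; `realise` then supplies the parent
-- vector.
record EO (G : Graph n) (D : Fin n → Fin n → Set) : Set where
  field
    D?      : ∀ u v → Dec (D u v)
    D-refl  : ∀ {u} → D u u
    D-trans : ∀ {u v w} → D u v → D v w → D u w
    D-anti  : ∀ {u v} → D u v → D v u → u ≡ v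
    D-chain : ∀ {u v w} → D u w → D v w → D u v ⊎ D v u
    D-comp  : ∀ {u v} → Adj G u v → D u v ⊎ D v u
    D-conn  : ∀ {u v} → D u v → Reach G (D u) u v

finite-max : {P : VSet n} {D : Fin n → Fin n → Set} → (∀ v → Dec (P v)) →
  (∀ {u v w} → D u v → D v w → D u w) → (∀ {u v} → P u → P v → D u v ⊎ D v u) →
  ∃ P → ∃ λ m → P m × (∀ w → P w → D w m)
finite-max {n} {P} {D} P? tr tot (p , Pp) with go (allFin n)
  where
  go : ∀ xs → (∀ w → w ∈ˡ xs → ¬ P w) ⊎ (∃ λ m → P m × (∀ w → w ∈ˡ xs → P w → D w m))
  go [] = inj₁ λ _ ()
  go (x ∷ xs) with P? x | go xs
  ... | no ¬p | inj₁ none = inj₁ λ { w (here refl) → ¬p ; w (there i) → none w i }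
  ... | no ¬p | inj₂ (m , Pm , f) = inj₂ (m , Pm , λ { w (here refl) q → ⊥-elim (¬p q) ; w (there i) → f w i })
  ... | yes q | inj₁ none = inj₂ (x , q , λ { w (here refl) _ → [ id , id ] (tot q q) ; w (there i) r → ⊥-elim (none w i r) })
  ... | yes q | inj₂ (m , Pm , f) with tot q Pm
  ...   | inj₁ xm = inj₂ (m , Pm , λ { w (here refl) _ → xm ; w (there i) → f w i })
  ...   | inj₂ mx = inj₂ (x , q , λ { w (here refl) _ → [ id , id ] (tot q q) ; w (there i) r → tr (f w i r) mx })
... | inj₁ none = ⊥-elim (none p (∈-allFin p) Pp)
... | inj₂ (m , Pm , f) = m , Pm , λ w → f w (∈-allFin w)

record Realises (G : Graph n) (D : Fin n → Fin n → Set) : Set where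
  field
    forest : Forest n
    isEF   : EF G forest
    to     : ∀ {u v} → Desc forest u v → D u v
    from   : ∀ {u v} → D u v → Desc forest u v

realise : {D : Fin n → Fin n → Set} → EO G D → Realises G D
realise {n} {G} {D} O = record
  { forest = T₀ ; isEF = record { rooted = rooted ; comp = comp ; conn = λ d → reach-mono from (D-conn (to d)) }
  ; to = to ; from = from }
  where
  open EO O

  isParent? : ∀ v u → Dec (IsParent D v u)
  isParent? v u = D? u v ×-dec ¬? (u ≟ v) ×-dec all? (λ w → D? w v →-dec ¬? (w ≟ v) →-dec D? w u)

  par : Fin n → Maybe (Fin n)
  par v with any? (isParent? v)
  ... | yes (u , _) = just u
  ... | no _        = nothing

  T₀ : Forest n
  T₀ = tabulate par

  par⁻ : par v ≡ just u → IsParent D v u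
  par⁻ {v = v} e with any? (isParent? v)
  par⁻ refl | yes (_ , p) = p

  par-none : par v ≡ nothing → ∀ {u} → ¬ IsParent D v u
  par-none {v = v} e p with any? (isParent? v)
  par-none () p | yes _
  ... | no ¬p = ¬p (_ , p)

  lookup-par : lookup T₀ v ≡ par v
  lookup-par {v} = lookup∘tabulate par v

  deepest : D u v → u ≢ v → ∃ (IsParent D v)
  deepest {u} {v} d u≢v with finite-max {P = λ w → D w v × w ≢ v} {D = D}
      (λ w → D? w v ×-dec ¬? (w ≟ v)) D-trans (λ p q → D-chain (proj₁ p) (proj₁ q)) (u , d , u≢v)
  ... | m , (dm , m≢v) , f = m , dm , m≢v , λ w dw w≢v → f w (dw , w≢v)

  rooted : ∀ v → Rooted T₀ v
  rooted v = go _ v ℕ.≤-refl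
    where
    -- `m` bounds the number of ancestors of `v`, which drops at the parent by antisymmetry; `v` is
    -- its own ancestor, so the bound `zero` is impossible.
    go : ∀ m v → ∣ subset (λ w → D? w v) ∣ ≤ⁿ m → Rooted T₀ v
    go m v le with par v in e
    ... | nothing = root (trans lookup-par e)
    go zero v le | just u = ⊥-elim (ℕ.n≮0 (ℕ.<-≤-trans
      (subset-< (λ _ → no λ ()) (λ w → D? w v) ⊥-elim D-refl id) le))
    go (suc m) v le | just u with par⁻ e
    ... | d , u≢v , _ = child (trans lookup-par e) (go m u (ℕ.≤-pred (ℕ.≤-trans
      (subset-< (λ w → D? w u) (λ w → D? w v) (λ q → D-trans q d) D-refl (λ q → u≢v (D-anti d q))) le)))

  to : Desc T₀ u v → D u v
  to self        = D-refl
  to (below e d) = D-trans (to d) (proj₁ (par⁻ (trans (≡-sym lookup-par) e)))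

  from : D u v → Desc T₀ u v
  from {v = v} = go (rooted v)
    where
    go : ∀ {u v} → Rooted T₀ v → D u v → Desc T₀ u v
    go {u} {v} r d with u ≟ v
    ... | yes refl = self
    go (root e) d | no u≢v = ⊥-elim (par-none (trans (≡-sym lookup-par) e) (proj₂ (deepest d u≢v)))
    go (child e r) d | no u≢v =
      below e (go r (proj₂ (proj₂ (par⁻ (trans (≡-sym lookup-par) e))) _ d u≢v))

  comp : Adj G u v → Desc T₀ u v ⊎ Desc T₀ v u
  comp a with D-comp a
  ... | inj₁ d = inj₁ (from d)
  ... | inj₂ d = inj₂ (from d)

-- Flips: rotations described by descendant sets

-- Nothing is recorded about the new subtrees of `i` and `j` except that `i` is below `j`: between
-- elimination forests, connectivity and comparability force them. This makes flips easy to verify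
-- and to reverse.
record Flip (F : Forest n) (i j : Fin n) (F' : Forest n) : Set where
  field
    edge  : lookup F j ≡ just i
    rev   : Desc F' j i
    same  : ∀ {u v} → u ≢ i → u ≢ j → Desc F u v → Desc F' u v
    same⁻ : ∀ {u v} → u ≢ i → u ≢ j → Desc F' u v → Desc F u v

-- The subtree that `i` has after the rotation.
Cut : Graph n → Forest n → Fin n → Fin n → VSet n
Cut G F i j = Reach G (λ v → Desc F i v × v ≢ j) i

module _ {n} {G : Graph n} {F : Forest n} {i j : Fin n} (ef : EF G F) (e : lookup F j ≡ just i) where
  open EF ef

  cut-i : Cut G F i j i
  cut-i = here (self , parent⇒≢ e)

  between : Desc F i u → Desc F u j → u ≢ i → u ≡ j
  between {u = u} iu uj u≢i with u ≟ j
  ... | yes u≡j = u≡j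
  ... | no u≢j = ⊥-elim (u≢i (antisym (above-parent e uj u≢j) iu))

  subtree-reach : Desc F i u → u ≢ i → u ≢ j → Desc F u v →
                  Reach G (λ v → Desc F i v × v ≢ j) u v
  subtree-reach {u = u} iu u≢i u≢j uv =
    reach-mono (λ ua → desc-trans iu ua , λ { refl → u≢j (between iu ua u≢i) }) (conn uv)

  cut-down : Cut G F i j u → u ≢ i → Desc F u v → Cut G F i j v
  cut-down c u≢i uv with reach-target c
  ... | iu , u≢j = reach-trans c (subtree-reach iu u≢i u≢j uv)

  cut-up : Desc F i u → u ≢ j → Desc F u v → Cut G F i j v → Cut G F i j u
  cut-up {u = u} iu u≢j uv c with u ≟ i
  ... | yes refl = cut-i
  ... | no u≢i = reach-trans c (reach-sym (subtree-reach iu u≢i u≢j uv))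

  -- The subtree of `i` is connected, so some walk leads from `v` to `i` inside it. It can leave the
  -- subtree of `v` only towards a strict ancestor of `v`, and within the subtree of `i` the only
  -- one is `i`; so `j` is not met before `i` is reached.
  cut-child : lookup F v ≡ just i → v ≢ j → Cut G F i j v
  cut-child {v = v} e' v≢j with reach-closed P (inj₁ self) closed (reach-sym (conn (parent-desc e')))
    where
    v≢i : v ≢ i
    v≢i eq = parent⇒≢ e' (≡-sym eq)
    P : VSet n
    P a = Desc F v a ⊎ Reach G (λ v → Desc F i v × v ≢ j) v i
    closed : ∀ {a b} → P a → Desc F i a → Desc F i b → Adj G a b → P b
    closed (inj₂ r) _ _ _ = inj₂ r
    closed {a} {b} (inj₁ va) _ ib ad with comp ad
    ... | inj₁ ab = inj₁ (desc-trans va ab)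
    ... | inj₂ ba with desc-chain va ba
    ...   | inj₁ vb = inj₁ vb
    ...   | inj₂ bv with b ≟ v
    ...     | yes refl = inj₁ self
    ...     | no b≢v with antisym (above-parent e' bv b≢v) ib
    ...       | refl = inj₂ (reach-snoc (subtree-reach (parent-desc e') v≢i v≢j va) ad (self , parent⇒≢ e))
  ... | inj₁ vi = ⊥-elim (acyclic (rooted v) e' vi)
  ... | inj₂ r = reach-sym r

  cut? : ∀ v → Dec (Cut G F i j v)
  cut? v = reach? G (λ w → dec i w ×-dec ¬? (w ≟ j)) i v

  data FlipD : Fin n → Fin n → Set where
    at-j  : Desc F i v → FlipD j v
    at-i  : Cut G F i j v → FlipD i v
    other : u ≢ i → u ≢ j → Desc F u v → FlipD u v

  private
    i≢j : i ≢ j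
    i≢j = parent⇒≢ e

    ij : Desc F i j
    ij = parent-desc e

    cut⇒desc : Cut G F i j v → Desc F i v
    cut⇒desc c = proj₁ (reach-target c)

    cut⇒≢ : Cut G F i j v → v ≢ j
    cut⇒≢ c = proj₂ (reach-target c)

  flip-order : EO G FlipD
  flip-order = record
    { D? = D? ; D-refl = D-refl ; D-trans = D-trans ; D-anti = D-anti ; D-chain = D-chain
    ; D-comp = D-comp ; D-conn = D-conn }
    where
    D? : ∀ u v → Dec (FlipD u v)
    D? u v with u ≟ j | u ≟ i
    ... | yes refl | _ = map′ at-j (λ { (at-j d) → d ; (at-i _) → ⊥-elim (i≢j refl) ; (other _ ne _) → ⊥-elim (ne refl) }) (dec i v)
    ... | no u≢j | yes refl = map′ at-i (λ { (at-j d) → ⊥-elim (u≢j refl) ; (at-i c) → c ; (other ne _ _) → ⊥-elim (ne refl) }) (cut? v)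
    ... | no u≢j | no u≢i = map′ (other u≢i u≢j) (λ { (at-j d) → ⊥-elim (u≢j refl) ; (at-i c) → ⊥-elim (u≢i refl) ; (other _ _ d) → d }) (dec u v)

    D-refl : FlipD u u
    D-refl {u} with u ≟ j | u ≟ i
    ... | yes refl | _        = at-j ij
    ... | no _     | yes refl = at-i cut-i
    ... | no u≢j   | no u≢i   = other u≢i u≢j self

    D-trans : FlipD u v → FlipD v w → FlipD u w
    D-trans (at-j d)      (at-j q)        = at-j q
    D-trans (at-j d)      (at-i c)        = at-j (cut⇒desc c)
    D-trans (at-j d)      (other _ _ q)   = at-j (desc-trans d q)
    D-trans (at-i c)      (at-j q)        = ⊥-elim (cut⇒≢ c refl)
    D-trans (at-i c)      (at-i q)        = at-i q
    D-trans (at-i c)      (other v≢i _ q) = at-i (cut-down c v≢i q)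
    D-trans (other x y d) (at-j q)        = other x y (desc-trans (above-parent e d y) q)
    D-trans (other x y d) (at-i c)        = other x y (desc-trans d (cut⇒desc c))
    D-trans (other x y d) (other _ _ q)   = other x y (desc-trans d q)

    D-anti : FlipD u v → FlipD v u → u ≡ v
    D-anti (at-j d)      (at-j q)      = refl
    D-anti (at-j d)      (at-i c)      = ⊥-elim (cut⇒≢ c refl)
    D-anti (at-j d)      (other x y q) = ⊥-elim (y (between d q x))
    D-anti (at-i c)      (at-j q)      = ⊥-elim (cut⇒≢ c refl)
    D-anti (at-i c)      (at-i q)      = refl
    D-anti (at-i c)      (other x y q) = antisym (cut⇒desc c) q
    D-anti (other x y d) (at-j q)      = ⊥-elim (y (between q d x))
    D-anti (other x y d) (at-i c)      = antisym d (cut⇒desc c)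
    D-anti (other x y d) (other _ _ q) = antisym d q

    chain-j : Desc F i w → u ≢ i → u ≢ j → Desc F u w → FlipD j u ⊎ FlipD u j
    chain-j d x y q with desc-chain d q
    ... | inj₁ iu = inj₁ (at-j iu)
    ... | inj₂ ui = inj₂ (other x y (desc-trans ui ij))

    chain-i : Cut G F i j w → u ≢ i → u ≢ j → Desc F u w → FlipD i u ⊎ FlipD u i
    chain-i c x y q with desc-chain (cut⇒desc c) q
    ... | inj₁ iu = inj₁ (at-i (cut-up iu y q c))
    ... | inj₂ ui = inj₂ (other x y ui)

    D-chain : FlipD u w → FlipD v w → FlipD u v ⊎ FlipD v u
    D-chain (at-j d)      (at-j q)      = inj₁ D-refl
    D-chain (at-j d)      (at-i c)      = inj₁ (at-j self)
    D-chain (at-j d)      (other x y q) = chain-j d x y q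
    D-chain (at-i c)      (at-j q)      = inj₂ (at-j self)
    D-chain (at-i c)      (at-i q)      = inj₁ D-refl
    D-chain (at-i c)      (other x y q) = chain-i c x y q
    D-chain (other x y d) (at-j q)      = swap (chain-j q x y d)
    D-chain (other x y d) (at-i c)      = swap (chain-i c x y d)
    D-chain (other x y d) (other s t q) with desc-chain d q
    ... | inj₁ uv = inj₁ (other x y uv)
    ... | inj₂ vu = inj₂ (other s t vu)

    comp-below : Adj G u v → Desc F u v → FlipD u v ⊎ FlipD v u
    comp-below {u} {v} a d with u ≟ j | u ≟ i
    ... | yes refl | _ = inj₁ (at-j (desc-trans ij d))
    ... | no u≢j | no u≢i = inj₁ (other u≢i u≢j d)
    ... | no u≢j | yes refl with v ≟ j
    ...   | yes refl = inj₂ (at-j self)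
    ...   | no v≢j = inj₁ (at-i (reach-snoc cut-i a (d , v≢j)))

    D-comp : Adj G u v → FlipD u v ⊎ FlipD v u
    D-comp a with comp a
    ... | inj₁ d = comp-below a d
    ... | inj₂ d = swap (comp-below (Adj-sym G a) d)

    D-conn : FlipD u v → Reach G (FlipD u) u v
    D-conn (at-j d)      = reach-mono at-j (reach-trans (reach-sym (conn ij)) (conn d))
    D-conn (at-i c)      = reach-mono at-i (reach-within c)
    D-conn (other x y d) = reach-mono (other x y) (conn d)

  flip-exists : ∃ λ F' → EF G F' × Flip F i j F'
  flip-exists = forest , isEF , record
    { edge = e ; rev = from (at-j self) ; same = λ x y d → from (other x y d) ; same⁻ = λ x y d → back x y (to d) }
    where
    open Realises (realise flip-order)
    back : u ≢ i → u ≢ j → FlipD u v → Desc F u v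
    back x y (at-j _)      = ⊥-elim (y refl)
    back x y (at-i _)      = ⊥-elim (x refl)
    back x y (other _ _ d) = d

module _ {n} {G : Graph n} {F F' : Forest n} {i j : Fin n} (ef : EF G F) (ef' : EF G F') (fl : Flip F i j F') where
  private
    module A = EF ef
    module B = EF ef'
  open Flip fl

  private
    i≢j : i ≢ j
    i≢j = A.parent⇒≢ edge

    ij : Desc F i j
    ij = parent-desc edge

  -- A walk inside the old subtree of `i` could leave the new subtree of `j` only at a strict
  -- ancestor of `j` in `F'`. Apart from `i` and `j`, such a vertex is an ancestor of `j` in `F`
  -- too, and none lies in the subtree of `i`, as `j` is a child of `i`.
  flip-j⁺ : Desc F i v → Desc F' j v
  flip-j⁺ d = reach-closed (Desc F' j) rev closed (A.conn d)
    where
    closed : ∀ {a b} → Desc F' j a → Desc F i a → Desc F i b → Adj G a b → Desc F' j b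
    closed {a} {b} ja _ ib ad with B.comp ad
    ... | inj₁ ab = desc-trans ja ab
    ... | inj₂ ba with desc-chain ja ba
    ...   | inj₁ jb = jb
    ...   | inj₂ bj with b ≟ j | b ≟ i
    ...     | yes refl | _        = self
    ...     | no _     | yes refl = rev
    ...     | no b≢j   | no b≢i   = ⊥-elim (b≢j (between ef edge ib (same⁻ b≢i b≢j bj) b≢i))

  flip-j⁻ : Desc F' j v → Desc F i v
  flip-j⁻ d = reach-closed (Desc F i) ij closed (B.conn d)
    where
    closed : ∀ {a b} → Desc F i a → Desc F' j a → Desc F' j b → Adj G a b → Desc F i b
    closed {a} {b} ia _ jb ad with A.comp ad
    ... | inj₁ ab = desc-trans ia ab
    ... | inj₂ ba with desc-chain ia ba
    ...   | inj₁ ib = ib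
    ...   | inj₂ bi with b ≟ j | b ≟ i
    ...     | yes refl | _        = ij
    ...     | no _     | yes refl = self
    ...     | no b≢j   | no b≢i   = ⊥-elim (b≢j (B.antisym (same b≢i b≢j (desc-trans bi ij)) jb))

  flip-i⁺ : Cut G F i j v → Desc F' i v
  flip-i⁺ = reach-closed (Desc F' i) self closed
    where
    closed : ∀ {a b} → Desc F' i a → Desc F i a × a ≢ j → Desc F i b × b ≢ j → Adj G a b → Desc F' i b
    closed {a} {b} ia _ (ib , b≢j) ad with B.comp ad
    ... | inj₁ ab = desc-trans ia ab
    ... | inj₂ ba with desc-chain ia ba
    ...   | inj₁ ib' = ib'
    ...   | inj₂ bi with b ≟ i
    ...     | yes refl = self
    ...     | no b≢i   = ⊥-elim (b≢i (A.antisym (same⁻ b≢i b≢j bi) ib))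

  flip-i⁻ : Desc F' i v → Cut G F i j v
  flip-i⁻ d = reach-mono (λ ia → flip-j⁻ (desc-trans rev ia) , λ { refl → i≢j (B.antisym ia rev) }) (B.conn d)

  private
    ≡-maybe : {x y : Maybe (Fin n)} → (∀ u → x ≡ just u → y ≡ just u) → (∀ u → y ≡ just u → x ≡ just u) → x ≡ y
    ≡-maybe {x = nothing} {nothing} f g = refl
    ≡-maybe {x = nothing} {just u}  f g = g u refl
    ≡-maybe {x = just u}  {y}       f g = ≡-sym (f u refl)

    strict-anc : Desc F' w j → w ≢ j → w ≢ i × Desc F w i
    strict-anc {w = w} wj w≢j with w ≟ i
    ... | yes refl = ⊥-elim (w≢j (B.antisym wj rev))
    ... | no w≢i = w≢i , A.above-parent edge (same⁻ w≢i w≢j wj) w≢j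

    strict-anc⁻ : Desc F w i → w ≢ i → w ≢ j × Desc F' w j
    strict-anc⁻ {w = w} wi w≢i with w ≟ j
    ... | yes refl = ⊥-elim (w≢i (A.antisym wi ij))
    ... | no w≢j = w≢j , same w≢i w≢j (desc-trans wi ij)

    par-j : lookup F' j ≡ lookup F i
    par-j = ≡-maybe
      (λ u e → case parent⁺ B.rooted e of λ (d , u≢j , m) →
        let (u≢i , ui) = strict-anc d u≢j in
        parent⁻ A.rooted (ui , u≢i , λ w wi w≢i → let (w≢j , wj) = strict-anc⁻ wi w≢i in same⁻ w≢i w≢j (m w wj w≢j)))
      (λ u e → case parent⁺ A.rooted e of λ (d , u≢i , m) →
        let (u≢j , uj) = strict-anc⁻ d u≢i in
        parent⁻ B.rooted (uj , u≢j , λ w wj w≢j → let (w≢i , wi) = strict-anc wj w≢j in same w≢i w≢j (m w wi w≢i)))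

    par-i : lookup F' i ≡ just j
    par-i = parent⁻ B.rooted (rev , (λ eq → i≢j (≡-sym eq)) , up)
      where
      up : ∀ w → Desc F' w i → w ≢ i → Desc F' w j
      up w wi w≢i with w ≟ j
      ... | yes refl = self
      ... | no w≢j = same w≢i w≢j (desc-trans (same⁻ w≢i w≢j wi) ij)

    par-other : ∀ v → v ≢ i → v ≢ j → lookup F v ≢ just j → lookup F' v ≡ lookup F v
    par-other v v≢i v≢j ¬ch with lookup F v in e
    ... | nothing = none
      where
      none : lookup F' v ≡ nothing
      none with lookup F' v in e'
      ... | nothing = refl
      ... | just p with parent⁺ B.rooted e'
      ...   | pv , p≢v , _ = ⊥-elim (p≢v (anc p pv))
        where
        orphan : ∀ p → Desc F p v → p ≡ v
        orphan p self         = refl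
        orphan p (below e' _) = ⊥-elim (nothing≢just e e')
        anc : ∀ p → Desc F' p v → p ≡ v
        anc p pv with p ≟ j | p ≟ i
        ... | yes refl | _        = ⊥-elim (v≢i (≡-sym (orphan i (flip-j⁻ pv))))
        ... | no _     | yes refl = ⊥-elim (v≢i (≡-sym (orphan i (flip-j⁻ (desc-trans rev pv)))))
        ... | no p≢j   | no p≢i   = orphan p (same⁻ p≢i p≢j pv)
    ... | just u with parent⁺ A.rooted e
    ...   | uv , u≢v , m with u ≟ i
    ...     | yes refl = parent⁻ B.rooted (flip-i⁺ cv , u≢v , up)
      where
      cv : Cut G F i j v
      cv = cut-child ef edge e v≢j
      up : ∀ w → Desc F' w v → w ≢ v → Desc F' w i
      up w wv w≢v with w ≟ j | w ≟ i
      ... | yes refl | _        = rev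
      ... | no _     | yes refl = self
      ... | no w≢j   | no w≢i   = same w≢i w≢j (m w (same⁻ w≢i w≢j wv) w≢v)
    ...     | no u≢i = parent⁻ B.rooted (same u≢i u≢j uv , u≢v , up)
      where
      u≢j : u ≢ j
      u≢j refl = ¬ch refl
      up : ∀ w → Desc F' w v → w ≢ v → Desc F' w u
      up w wv w≢v with w ≟ j | w ≟ i
      ... | yes refl | _        = flip-j⁺ (m i (flip-j⁻ wv) (v≢i ∘ ≡-sym))
      ... | no _     | yes refl = flip-i⁺ (cut-up ef edge (m i (flip-j⁻ (desc-trans rev wv)) (v≢i ∘ ≡-sym)) u≢j uv (flip-i⁻ wv))
      ... | no w≢j   | no w≢i   = same w≢i w≢j (m w (same⁻ w≢i w≢j wv) w≢v)

  flip⇒rot : Rot G F i j F'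
  flip⇒rot = edge , par-j , par-i , par-other , λ c e c≢i →
      -- `SameComp` speaks of the whole subtree of `c`. That subtree is connected and avoids `j`, so
      -- testing `c` alone is enough.
      (λ sc → child-i c e c≢i (sc c self))
    , (λ ¬sc → child-j c e c≢i (λ cc → ¬sc λ s cs → cut-down ef edge cc c≢i cs))
    where
    module _ (c : Fin n) (e : lookup F c ≡ just j) (c≢i : c ≢ i) where
      jc : Desc F j c
      jc = parent-desc e
      j≢c : j ≢ c
      j≢c = A.parent⇒≢ e
      child-i : Cut G F i j c → lookup F' c ≡ just i
      child-i cc = parent⁻ B.rooted (flip-i⁺ cc , (λ eq → c≢i (≡-sym eq)) , up)
        where
        up : ∀ w → Desc F' w c → w ≢ c → Desc F' w i
        up w wc w≢c with w ≟ j | w ≟ i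
        ... | yes refl | _        = rev
        ... | no _     | yes refl = self
        ... | no w≢j   | no w≢i   = same w≢i w≢j (A.above-parent edge (A.above-parent e (same⁻ w≢i w≢j wc) w≢c) w≢j)
      child-j : ¬ Cut G F i j c → lookup F' c ≡ just j
      child-j ¬cc = parent⁻ B.rooted (flip-j⁺ (desc-trans ij jc) , j≢c , up)
        where
        up : ∀ w → Desc F' w c → w ≢ c → Desc F' w j
        up w wc w≢c with w ≟ j | w ≟ i
        ... | yes refl | _        = self
        ... | no _     | yes refl = ⊥-elim (¬cc (flip-i⁻ wc))
        ... | no w≢j   | no w≢i   = same w≢i w≢j (A.above-parent e (same⁻ w≢i w≢j wc) w≢c)

  flip-sym : Flip F' j i F
  flip-sym = record { edge = par-i ; rev = ij ; same = λ x y → same⁻ y x ; same⁻ = λ x y → same y x }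

-- The children of `j` are placed by `SameComp` or by its negation. Reachability is decidable, so
-- one of the two holds for each child and every entry of the vector is forced.
rot-unique : EF G F → ∀ {F₁ F₂} → Rot G F i j F₁ → Rot G F i j F₂ → F₁ ≡ F₂
rot-unique {n} {G} {F} {i} {j} ef {F₁} {F₂} (e , j₁ , i₁ , o₁ , c₁) (_ , j₂ , i₂ , o₂ , c₂) =
  trans (≡-sym (tabulate∘lookup F₁)) (trans (tabulate-cong eq) (tabulate∘lookup F₂))
  where
  eq : ∀ v → lookup F₁ v ≡ lookup F₂ v
  eq v with v ≟ i | v ≟ j | maybe-≡-dec _≟_ (lookup F v) (just j)
  ... | yes refl | _        | _ = trans i₁ (≡-sym i₂)
  ... | no _     | yes refl | _ = trans j₁ (≡-sym j₂)
  ... | no v≢i   | no v≢j   | no ¬ch = trans (o₁ v v≢i v≢j ¬ch) (≡-sym (o₂ v v≢i v≢j ¬ch))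
  ... | no v≢i   | no v≢j   | yes ch with cut? ef e v
  ...   | yes cv = let sc = λ s vs → cut-down ef e cv v≢i vs in
                   trans (proj₁ (c₁ v ch v≢i) sc) (≡-sym (proj₁ (c₂ v ch v≢i) sc))
  ...   | no ¬cv = let ¬sc = λ sc → ¬cv (sc v self) in
                   trans (proj₂ (c₁ v ch v≢i) ¬sc) (≡-sym (proj₂ (c₂ v ch v≢i) ¬sc))

-- The flip along the same edge exists and is a rotation, so uniqueness identifies it with the given
-- one.
rot⇒flip : EF G F → Rot G F i j F' → EF G F' × Flip F i j F'
rot⇒flip {F' = F'} ef r with flip-exists ef (proj₁ r)
... | F* , ef* , fl with rot-unique ef {F'} {F*} r (flip⇒rot ef ef* fl)
...   | refl = ef* , fl

rot-asym : EF G F → Rot G F i j F' → lookup F i ≢ just j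
rot-asym ef r e = acyclic (EF.rooted ef _) e (parent-desc (proj₁ r))

-- Inserting the last vertex: the path of forests over one forest

-- `G` is `G'` without `k`, with absence encoded as isolation. `bound` makes `k` the largest vertex
-- on any edge, hence the first choice of Algorithm R.
record Extends {n} (G G' : Graph n) (k : Fin n) : Set where
  field
    old    : ∀ {u v} → Adj G u v → Adj G' u v
    fresh  : ∀ {u v} → Adj G u v → u ≢ k
    new    : ∀ {u v} → Adj G' u v → u ≢ k → v ≢ k → Adj G u v
    clique : ∀ {u v} → Adj G' k u → Adj G' k v → u ≢ v → Adj G' u v
    bound  : ∀ {u v} → Adj G' u v → u ≤ᶠ k

module Insertion {n} {G G' : Graph n} {k : Fin n} (X : Extends G G' k) where
  open Extends X

  private variable
    T T' T⁺ : Forest n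

  below-k : EF G F → Desc F k v → v ≡ k
  below-k ef d with EF.conn ef d
  ... | here _     = refl
  ... | step _ a _ = ⊥-elim (fresh a refl)

  above-k : EF G F → Desc F u k → u ≡ k
  above-k ef d with reach-sym (EF.conn ef d)
  ... | here _     = refl
  ... | step _ a _ = ⊥-elim (fresh a refl)

  record Del (T F : Forest n) : Set where
    field
      del⁺ : ∀ {u v} → u ≢ k → v ≢ k → Desc T u v → Desc F u v
      del⁻ : ∀ {u v} → u ≢ k → v ≢ k → Desc F u v → Desc T u v
  open Del

  Fib : Forest n → Forest n → Set
  Fib F T = EF G' T × Del T F

  _⊑_ : Forest n → Forest n → Set
  T ⊑ T' = ∀ u → Desc T u k → Desc T' u k

  Leaf Top : Forest n → Set
  Leaf T = ∀ v → Desc T k v → v ≡ k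
  Top T = ∀ u → Desc T u k → u ≡ k

  -- Subtrees stay connected because a walk through the simplicial vertex `k` can skip it; `k`
  -- itself becomes a one-vertex tree.
  del-exists : EF G' T → ∃ λ F → EF G F × Del T F
  del-exists {T} ef = forest , isEF , record
    { del⁺ = λ x y d → from (inj₂ (x , y , d))
    ; del⁻ = λ x y d → [ (λ { refl → self }) , proj₂ ∘ proj₂ ] (to d) }
    where
    open EF ef
    D : Fin n → Fin n → Set
    D u v = u ≡ v ⊎ (u ≢ k × v ≢ k × Desc T u v)

    D-trans : D u v → D v w → D u w
    D-trans (inj₁ refl) q = q
    D-trans p (inj₁ refl) = p
    D-trans (inj₂ (x , _ , d)) (inj₂ (_ , y , q)) = inj₂ (x , y , desc-trans d q)

    D-anti : D u v → D v u → u ≡ v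
    D-anti (inj₁ e) _ = e
    D-anti _ (inj₁ e) = ≡-sym e
    D-anti (inj₂ (_ , _ , d)) (inj₂ (_ , _ , q)) = antisym d q

    D-chain : D u w → D v w → D u v ⊎ D v u
    D-chain (inj₁ refl) q = inj₂ q
    D-chain p (inj₁ refl) = inj₁ p
    D-chain (inj₂ (x , _ , d)) (inj₂ (y , _ , q)) with desc-chain d q
    ... | inj₁ p = inj₁ (inj₂ (x , y , p))
    ... | inj₂ p = inj₂ (inj₂ (y , x , p))

    D-comp : Adj G u v → D u v ⊎ D v u
    D-comp a with comp (old a)
    ... | inj₁ d = inj₁ (inj₂ (fresh a , fresh (Adj-sym G a) , d))
    ... | inj₂ d = inj₂ (inj₂ (fresh (Adj-sym G a) , fresh a , d))

    D-conn : D u v → Reach G (D u) u v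
    D-conn (inj₁ refl) = here (inj₁ refl)
    D-conn (inj₂ (x , y , d)) =
      reach-map (λ a p q → new a (proj₂ p) (proj₂ q)) (λ (d , ne) → inj₂ (x , ne , d))
        (reach-avoid k (λ _ _ → clique) (conn d) x y)

    order : EO G D
    order = record
      { D? = λ u v → u ≟ v ⊎-dec (¬? (u ≟ k) ×-dec ¬? (v ≟ k) ×-dec dec u v)
      ; D-refl = inj₁ refl ; D-trans = D-trans ; D-anti = D-anti ; D-chain = D-chain
      ; D-comp = D-comp ; D-conn = D-conn }

    open Realises (realise order)

  del-unique : EF G F → EF G F₁ → Del T F → Del T F₁ → F ≡ F₁
  del-unique {F} {F₁} ef ef₁ dl dl₁ = desc-ext (EF.rooted ef) (EF.rooted ef₁) (go ef dl dl₁) (go ef₁ dl₁ dl)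
    where
    go : ∀ {T A B u v} → EF G A → Del T A → Del T B → Desc A u v → Desc B u v
    go {u = u} {v} ef p q d with u ≟ k | v ≟ k
    ... | yes refl | _ = subst (Desc _ k) (≡-sym (below-k ef d)) self
    ... | no _ | yes refl = subst (λ u → Desc _ u k) (≡-sym (above-k ef d)) self
    ... | no x | no y = del⁺ q x y (del⁻ p x y d)

  -- Away from `k` the order is that of `F`. The descendants of `k` follow from its ancestors: a
  -- walk inside the subtree of `k` in `T` could leave that in `T'` only at a strict ancestor of `k`
  -- in `T'`, which is then an ancestor of `k` in `T` as well.
  fib-det : Fib F T → Fib F T' → T ⊑ T' → T' ⊑ T → T ≡ T'
  fib-det {F} a b p q = desc-ext (EF.rooted (proj₁ a)) (EF.rooted (proj₁ b)) (go a b p q) (go b a q p)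
    where
    desc-k : ∀ {T T' v} → Fib F T → Fib F T' → T' ⊑ T → Desc T k v → Desc T' k v
    desc-k {T} {T'} (ef , _) (ef' , _) q d = reach-closed (Desc T' k) self closed (EF.conn ef d)
      where
      closed : ∀ {a b} → Desc T' k a → Desc T k a → Desc T k b → Adj G' a b → Desc T' k b
      closed {a} {b} ka _ kb ad with EF.comp ef' ad
      ... | inj₁ ab = desc-trans ka ab
      ... | inj₂ ba with desc-chain ka ba
      ...   | inj₁ kb' = kb'
      ...   | inj₂ bk with EF.antisym ef (q b bk) kb
      ...     | refl = self
    go : ∀ {T T' u v} → Fib F T → Fib F T' → T ⊑ T' → T' ⊑ T → Desc T u v → Desc T' u v
    go {u = u} {v} a b p q d with u ≟ k | v ≟ k
    ... | yes refl | _ = desc-k a b q d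
    ... | no _ | yes refl = p u d
    ... | no x | no y = del⁻ (proj₂ b) x y (del⁺ (proj₂ a) x y d)

  neighbour-below : Fib F T → Desc T u k → u ≢ k → ∃ λ w → Adj G' k w × Desc F u w
  neighbour-below (ef , dl) d u≢k with reach-sym (EF.conn ef d)
  ... | here _     = ⊥-elim (u≢k refl)
  ... | step _ a r = _ , a , del⁺ dl u≢k (Adj⇒≢ G' (Adj-sym G' a)) (reach-source r)

  -- The neighbours of k form a clique, hence lie on one branch.
  clique-chain : ∀ {a b} → EF G F → Adj G' k a → Adj G' k b → Desc F u a → Desc F v b → Desc F u v ⊎ Desc F v u
  clique-chain {a = a} {b} ef ka kb ua vb with a ≟ b
  ... | yes refl = desc-chain ua vb
  ... | no a≢b with EF.comp ef (new (clique ka kb a≢b) (Adj⇒≢ G' (Adj-sym G' ka)) (Adj⇒≢ G' (Adj-sym G' kb)))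
  ...   | inj₁ ab = desc-chain (desc-trans ua ab) vb
  ...   | inj₂ ba = desc-chain ua (desc-trans vb ba)

  -- In any forest over `F`, a strict ancestor of `k` lies above a neighbour of `k` in `F`. These
  -- candidates form one branch, and each set of ancestors is closed upwards in it, so two such sets
  -- are nested.
  ⊑-total : EF G F → Fib F T → Fib F T' → T ⊑ T' ⊎ T' ⊑ T
  ⊑-total {F} {T} {T'} efF a@(ef , dl) b@(ef' , dl') with all? (λ u → EF.dec ef u k →-dec EF.dec ef' u k)
  ... | yes p = inj₁ p
  ... | no ¬p with ¬∀⟶∃¬ n _ (λ u → EF.dec ef u k →-dec EF.dec ef' u k) ¬p
  ...   | u , ¬q with EF.dec ef u k
  ...     | no ¬d = ⊥-elim (¬q (⊥-elim ∘ ¬d))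
  ...     | yes uk = inj₂ go
    where
    ¬uk : ¬ Desc T' u k
    ¬uk d = ¬q (λ _ → d)
    u≢k : u ≢ k
    u≢k refl = ¬uk self
    go : T' ⊑ T
    go w wk with w ≟ k
    ... | yes refl = self
    ... | no w≢k with neighbour-below a uk u≢k | neighbour-below b wk w≢k
    ...   | x , kx , ux | y , ky , wy with clique-chain efF kx ky ux wy
    ...     | inj₁ uw = ⊥-elim (¬uk (desc-trans (del⁻ dl' u≢k w≢k uw) wk))
    ...     | inj₂ wu = desc-trans (del⁻ dl w≢k u≢k wu) uk

  -- As a leaf, `k` is below all its neighbours, hence below everything that can be an ancestor of
  -- `k` over `F`.
  leaf-max : Leaf T → Fib F T → Fib F T' → T' ⊑ T
  leaf-max lf (ef , dl) b u uk with u ≟ k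
  ... | yes refl = self
  ... | no u≢k with neighbour-below b uk u≢k
  ...   | w , kw , uw with EF.comp ef kw
  ...     | inj₁ kw' = ⊥-elim (Adj⇒≢ G' kw (≡-sym (lf w kw')))
  ...     | inj₂ wk = desc-trans (del⁻ dl u≢k (Adj⇒≢ G' (Adj-sym G' kw)) uw) wk

  top-min : Top T → T ⊑ T'
  top-min tp u uk = subst (λ u → Desc _ u k) (≡-sym (tp u uk)) self

  -- `k` is hung below the lowest of its neighbours. The last component later keeps the labels of
  -- the first forest increasing away from the roots.
  leaf-exists : EF G F → ∃ λ T → Fib F T × Leaf T × (∀ {u} → u ≢ k → Desc T u k → ∃ λ w → Adj G' k w × Desc F u w)
  leaf-exists {F} ef = forest , (isEF , record { del⁺ = λ x y d → plus x y (to d) ; del⁻ = λ x y d → from (at-old x y d) })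
    , (λ v d → leaf (to d)) , (λ x d → anc x (to d))
    where
    open EF ef
    data D : Fin n → Fin n → Set where
      at-old : u ≢ k → v ≢ k → Desc F u v → D u v
      at-new : u ≢ k → ∀ {a} → Adj G' k a → Desc F u a → D u k
      at-k   : D k k

    leaf : D k v → v ≡ k
    leaf (at-old x _ _) = ⊥-elim (x refl)
    leaf (at-new x _ _) = refl
    leaf at-k           = refl

    plus : u ≢ k → v ≢ k → D u v → Desc F u v
    plus x y (at-old _ _ d)   = d
    plus x y (at-new _ _ _)   = ⊥-elim (y refl)
    plus x y at-k             = self

    anc : u ≢ k → D u k → ∃ λ w → Adj G' k w × Desc F u w
    anc x (at-old _ y d) = ⊥-elim (y refl)
    anc x (at-new _ a d) = _ , a , d
    anc x at-k           = ⊥-elim (x refl)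

    D? : ∀ u v → Dec (D u v)
    D? u v with u ≟ k | v ≟ k
    ... | yes refl | yes refl = yes at-k
    ... | yes refl | no y     = no (y ∘ leaf)
    ... | no x     | no y     = map′ (at-old x y) (plus x y) (dec u v)
    ... | no x     | yes refl = map′ (λ (w , a , d) → at-new x a d) (anc x) (any? λ w → adj? G' k w ×-dec dec u w)

    D-refl : D u u
    D-refl {u} with u ≟ k
    ... | yes refl = at-k
    ... | no x     = at-old x x self

    D-trans : D u v → D v w → D u w
    D-trans (at-old x y d) (at-old _ z q) = at-old x z (desc-trans d q)
    D-trans (at-old x y d) (at-new _ a q) = at-new x a (desc-trans d q)
    D-trans (at-old x y d) at-k           = ⊥-elim (y refl)
    D-trans (at-new x a d) q with leaf q
    ... | refl = at-new x a d
    D-trans at-k           q = q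

    D-anti : D u v → D v u → u ≡ v
    D-anti (at-old x y d) (at-old _ _ q) = antisym d q
    D-anti (at-old x y d) (at-new _ _ q) = ⊥-elim (x refl)
    D-anti (at-old x y d) at-k           = refl
    D-anti (at-new x a d) q              = leaf q
    D-anti at-k           q              = refl

    D-chain : D u w → D v w → D u v ⊎ D v u
    D-chain (at-old x y d) (at-old x' _ q) with desc-chain d q
    ... | inj₁ p = inj₁ (at-old x x' p)
    ... | inj₂ p = inj₂ (at-old x' x p)
    D-chain (at-old x y d) (at-new _ _ _) = ⊥-elim (y refl)
    D-chain p              at-k           = inj₁ p
    D-chain (at-new x a d) (at-old _ y _) = ⊥-elim (y refl)
    D-chain (at-new x a d) (at-new x' b q) with clique-chain ef a b d q
    ... | inj₁ p = inj₁ (at-old x x' p)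
    ... | inj₂ p = inj₂ (at-old x' x p)
    D-chain at-k           q = inj₂ q

    D-comp : Adj G' u v → D u v ⊎ D v u
    D-comp {u} {v} a with u ≟ k | v ≟ k
    ... | yes refl | yes refl = inj₁ at-k
    ... | yes refl | no y     = inj₂ (at-new y a self)
    ... | no x     | yes refl = inj₁ (at-new x (Adj-sym G' a) self)
    ... | no x     | no y with comp (new a x y)
    ...   | inj₁ d = inj₁ (at-old x y d)
    ...   | inj₂ d = inj₂ (at-old y x d)

    old-reach : u ≢ k → v ≢ k → Desc F u v → Reach G' (D u) u v
    old-reach x y d = reach-mono (λ (p , y) → at-old x y p)
      (reach-avoid k (λ _ _ → clique) (reach-map (λ a _ _ → old a) id (conn d)) x y)

    D-conn : D u v → Reach G' (D u) u v
    D-conn (at-old x y d) = old-reach x y d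
    D-conn (at-new x a d) = reach-snoc (old-reach x (Adj⇒≢ G' (Adj-sym G' a)) d) (Adj-sym G' a) (at-new x a d)
    D-conn at-k           = here at-k

    order : EO G' D
    order = record
      { D? = D? ; D-refl = D-refl ; D-trans = D-trans ; D-anti = D-anti ; D-chain = D-chain
      ; D-comp = D-comp ; D-conn = D-conn }

    open Realises (realise order)

  module _ {T T⁺ : Forest n} {i : Fin n} (ef : EF G' T) (ef⁺ : EF G' T⁺) (fl : Flip T i k T⁺) where
    open Flip fl
    private
      i≢k : i ≢ k
      i≢k = EF.parent⇒≢ ef edge

    -- Since `k` can be bypassed, the subtree of `i` without `k` is connected, so `i` keeps all of
    -- it. An up-rotation of `k` thus stays in the fibre and only removes `i` from the ancestors of
    -- `k`.
    up-same : u ≢ k → v ≢ k → Desc T u v → Desc T⁺ u v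
    up-same {u} {v} x y d with u ≟ i
    ... | yes refl = flip-i⁺ ef ef⁺ fl (reach-avoid k (λ _ _ → clique) (EF.conn ef d) x y)
    ... | no u≢i = same u≢i x d

    up-same⁻ : u ≢ k → v ≢ k → Desc T⁺ u v → Desc T u v
    up-same⁻ {u} {v} x y d with u ≟ i
    ... | yes refl = proj₁ (reach-target (flip-i⁻ ef ef⁺ fl d))
    ... | no u≢i = same⁻ u≢i x d

    up-del : Del T F → Del T⁺ F
    up-del dl = record { del⁺ = λ x y d → del⁺ dl x y (up-same⁻ x y d) ; del⁻ = λ x y d → up-same x y (del⁻ dl x y d) }

    up-del⁻ : Del T⁺ F → Del T F
    up-del⁻ dl = record { del⁺ = λ x y d → del⁺ dl x y (up-same x y d) ; del⁻ = λ x y d → up-same⁻ x y (del⁻ dl x y d) }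

    up-anc⁺ : Desc T u k → u ≢ i → Desc T⁺ u k
    up-anc⁺ {u} d u≢i with u ≟ k
    ... | yes refl = self
    ... | no u≢k = same u≢i u≢k d

    up-anc⁻ : Desc T⁺ u k → Desc T u k × u ≢ i
    up-anc⁻ {u} d with u ≟ k | u ≟ i
    ... | yes refl | _ = self , i≢k ∘ ≡-sym
    ... | no _ | yes refl = ⊥-elim (i≢k (EF.antisym ef⁺ d rev))
    ... | no u≢k | no u≢i = same⁻ u≢i u≢k d , u≢i

  Moves : Forest n → Fin n → Forest n → Set
  Moves T i T⁺ = Rot G' T i k T⁺ ⊎ Rot G' T k i T⁺

  moves-fib : ∀ {i} → Fib F T → Moves T i T⁺ → Fib F T⁺
  moves-fib (ef , dl) (inj₁ r) with rot⇒flip ef r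
  ... | ef⁺ , fl = ef⁺ , up-del ef ef⁺ fl dl
  moves-fib (ef , dl) (inj₂ r) with rot⇒flip ef r
  ... | ef⁺ , fl = ef⁺ , up-del⁻ ef⁺ ef (flip-sym ef ef⁺ fl) dl

  edge-bound : EF G' T → lookup T v ≡ just u → u ≤ᶠ k × v ≤ᶠ k
  edge-bound ef e with EF.conn ef (parent-desc e) | reach-sym (EF.conn ef (parent-desc e))
  ... | here _     | _          = ⊥-elim (EF.parent⇒≢ ef e refl)
  ... | step _ _ _ | here _     = ⊥-elim (EF.parent⇒≢ ef e refl)
  ... | step _ a _ | step _ b _ = bound a , bound b

  -- T ≼ T₁ says that a sweep through the fibre of F meets T₁ no later than T.
  record Sweep (F : Forest n) : Set₁ where
    field
      _≼_ : Forest n → Forest n → Set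
      End : Forest n → Set
      μ   : ∀ {T} → EF G' T → ℕ
      ≼-refl : T ≼ T
      ≼-end : End T → Fib F T → Fib F T' → T ≼ T'
      -- After the move itself come: the new forest was not met before; what was met stays met;
      -- nothing but the new forest is added; and any other move at `k` leads to a forest already
      -- met or uses the same partner.
      advance : (f : Fib F T) → End T ⊎
        (∃ λ i → ∃ λ T⁺ → i <ᶠ k × Moves T i T⁺ × Σ (EF G' T⁺) λ ef⁺ → μ ef⁺ <ⁿ μ (proj₁ f)
          × ¬ (T ≼ T⁺)
          × (∀ T₁ → Fib F T₁ → T ≼ T₁ → T⁺ ≼ T₁)
          × (∀ T₁ → Fib F T₁ → T⁺ ≼ T₁ → T₁ ≡ T⁺ ⊎ T ≼ T₁)
          × (∀ i₂ T₂ → Moves T i₂ T₂ → T ≼ T₂ ⊎ i₂ ≡ i))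

  anc? : EF G' T → ∀ u → Dec (Desc T u k)
  anc? ef u = EF.dec ef u k

  ≤∧≢⇒<ᶠ : u ≤ᶠ k → u ≢ k → u <ᶠ k
  ≤∧≢⇒<ᶠ le ne = ℕ.≤∧≢⇒< le (ne ∘ toℕ-injective)

  sweep-up : EF G F → Sweep F
  sweep-up {F} efF = record
    { _≼_ = _⊑_ ; End = Top ; μ = λ ef → ∣ subset (anc? ef) ∣ ; ≼-refl = λ _ d → d
    ; ≼-end = λ tp _ _ → top-min tp ; advance = advance }
    where
    module _ {T} (f : Fib F T) where
      private
        ef = proj₁ f
      advance : Top T ⊎ _
      advance with lookup T k in e
      ... | nothing = inj₁ λ { u self → refl ; u (below e' _) → ⊥-elim (nothing≢just e e') }
      ... | just i with flip-exists ef e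
      ...   | T⁺ , ef⁺ , fl = inj₂ (i , T⁺ , ≤∧≢⇒<ᶠ (proj₁ (edge-bound ef e)) (EF.parent⇒≢ ef e)
          , inj₁ (flip⇒rot ef ef⁺ fl) , ef⁺
          , subset-< (anc? ef⁺) (anc? ef) (proj₁ ∘ up-anc⁻ ef ef⁺ fl) ik (λ d → proj₂ (up-anc⁻ ef ef⁺ fl d) refl)
          , (λ le → proj₂ (up-anc⁻ ef ef⁺ fl (le i ik)) refl)
          , (λ T₁ _ le u d → le u (proj₁ (up-anc⁻ ef ef⁺ fl d)))
          , behind , moves)
        where
        ik : Desc T i k
        ik = parent-desc e
        f⁺ : Fib F T⁺
        f⁺ = ef⁺ , up-del ef ef⁺ fl (proj₂ f)
        behind : ∀ T₁ → Fib F T₁ → T⁺ ⊑ T₁ → T₁ ≡ T⁺ ⊎ T ⊑ T₁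
        behind T₁ f₁ le with ⊑-total efF f f₁
        ... | inj₁ p = inj₂ p
        ... | inj₂ p with anc? (proj₁ f₁) i
        ...   | no ¬ik₁ = inj₁ (fib-det f₁ f⁺ (λ u d → up-anc⁺ ef ef⁺ fl (p u d) λ { refl → ¬ik₁ d }) le)
        ...   | yes ik₁ = inj₂ λ u d → case u ≟ i of λ
                { (yes refl) → ik₁ ; (no u≢i) → le u (up-anc⁺ ef ef⁺ fl d u≢i) }
        moves : ∀ i₂ T₂ → Moves T i₂ T₂ → T ⊑ T₂ ⊎ i₂ ≡ i
        moves i₂ T₂ (inj₁ r) = inj₂ (just-unique (proj₁ r) e)
        moves i₂ T₂ (inj₂ r) with rot⇒flip ef r
        ... | ef₂ , fl₂ = inj₁ λ u d → proj₁ (up-anc⁻ ef₂ ef (flip-sym ef ef₂ fl₂) d)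

  child-exists : Rooted T v → Desc T u v → u ≢ v → ∃ λ c → lookup T c ≡ just u
  child-exists R self u≢v = ⊥-elim (u≢v refl)
  child-exists (root x) (below e d) u≢v = ⊥-elim (nothing≢just x e)
  child-exists {u = u} (child {u = p} x R) (below e d) u≢v with just-unique x e | u ≟ p
  ... | refl | yes refl = _ , x
  ... | refl | no u≢p = child-exists R d u≢p

  sweep-down : EF G F → Sweep F
  sweep-down {F} efF = record
    { _≼_ = λ T T' → T' ⊑ T ; End = Leaf ; μ = λ ef → ∣ subset (λ u → ¬? (anc? ef u)) ∣ ; ≼-refl = λ _ d → d
    ; ≼-end = leaf-max ; advance = advance }
    where
    module _ {T} (f : Fib F T) where
      private
        ef = proj₁ f
      advance : Leaf T ⊎ _
      advance with any? (λ v → EF.dec ef k v ×-dec ¬? (v ≟ k))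
      ... | no ¬p = inj₁ λ v d → case v ≟ k of λ { (yes eq) → eq ; (no ne) → ⊥-elim (¬p (v , d , ne)) }
      ... | yes (v , d , v≢k) with child-exists (EF.rooted ef v) d (v≢k ∘ ≡-sym)
      ...   | c , e with flip-exists ef e
      ...     | T⁺ , ef⁺ , fl' = inj₂ (c , T⁺ , ≤∧≢⇒<ᶠ (proj₂ (edge-bound ef e)) (EF.parent⇒≢ ef e ∘ ≡-sym)
          , inj₂ (flip⇒rot ef ef⁺ fl') , ef⁺
          , subset-< (λ u → ¬? (anc? ef⁺ u)) (λ u → ¬? (anc? ef u)) (λ ¬d d → ¬d (mono _ d)) ¬ck (λ ¬d → ¬d ck⁺)
          , (λ le → ¬ck (le c ck⁺))
          , (λ T₁ _ le u d → mono u (le u d))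
          , behind , moves)
        where
        fl : Flip T⁺ c k T
        fl = flip-sym ef ef⁺ fl'
        mono : T ⊑ T⁺
        mono u d = proj₁ (up-anc⁻ ef⁺ ef fl d)
        ck⁺ : Desc T⁺ c k
        ck⁺ = Flip.rev fl'
        ¬ck : ¬ Desc T c k
        ¬ck d = proj₂ (up-anc⁻ ef⁺ ef fl d) refl
        f⁺ : Fib F T⁺
        f⁺ = moves-fib f (inj₂ (flip⇒rot ef ef⁺ fl'))
        behind : ∀ T₁ → Fib F T₁ → T₁ ⊑ T⁺ → T₁ ≡ T⁺ ⊎ T₁ ⊑ T
        behind T₁ f₁ le with ⊑-total efF f₁ f
        ... | inj₁ p = inj₂ p
        ... | inj₂ p with anc? (proj₁ f₁) c
        ...   | no ¬c = inj₂ λ u d → up-anc⁺ ef⁺ ef fl (le u d) λ { refl → ¬c d }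
        ...   | yes ck = inj₁ (fib-det f₁ f⁺ le λ u d → case u ≟ c of λ
                { (yes refl) → ck ; (no u≢c) → p u (up-anc⁺ ef⁺ ef fl d u≢c) })
        moves : ∀ i₂ T₂ → Moves T i₂ T₂ → T₂ ⊑ T ⊎ i₂ ≡ c
        moves i₂ T₂ (inj₁ r) with rot⇒flip ef r
        ... | ef₂ , fl₂ = inj₁ λ u d → proj₁ (up-anc⁻ ef ef₂ fl₂ d)
        -- Two down-rotations each add one ancestor to `k`. Both results lie in the same fibre and
        -- are nested, so the added ancestors agree: `k` has at most one child.
        moves i₂ T₂ m@(inj₂ r) with rot⇒flip ef r
        ... | ef₂ , fl₂' = inj₂ (eq (⊑-total efF (moves-fib f m) f⁺))
          where
          fl₂ : Flip T₂ i₂ k T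
          fl₂ = flip-sym ef ef₂ fl₂'
          eq : T₂ ⊑ T⁺ ⊎ T⁺ ⊑ T₂ → i₂ ≡ c
          eq (inj₁ le) with i₂ ≟ c
          ... | yes p = p
          ... | no i₂≢c = ⊥-elim (proj₂ (up-anc⁻ ef₂ ef fl₂ (up-anc⁺ ef⁺ ef fl (le i₂ (Flip.rev fl₂')) i₂≢c)) refl)
          eq (inj₂ le) with c ≟ i₂
          ... | yes p = ≡-sym p
          ... | no c≢i₂ = ⊥-elim (¬ck (up-anc⁺ ef₂ ef fl₂ (le c ck⁺) c≢i₂))

-- Traces of Algorithm R and complete enumerations

-- A trace with an arbitrary start. That the start is `F₀` is settled only at the end, for the whole
-- graph, from increasing labels.
data Tr {n} (G : Graph n) (F₀ : Forest n) : Forest n → List (Forest n) → Set where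
  begin : Tr G F₀ F₀ (F₀ ∷ [])
  more  : Tr G F₀ F Vis → Step G Vis F F' → Tr G F₀ F' (F' ∷ Vis)

step-EF : EF G F → Step G Vis F F' → EF G F'
step-EF ef (_ , _ , (_ , inj₁ r , _) , _) = proj₁ (rot⇒flip ef r)
step-EF ef (_ , _ , (_ , inj₂ r , _) , _) = proj₁ (rot⇒flip ef r)

tr-EF : EF G F₀ → Tr G F₀ F Vis → EF G F
tr-EF ef begin      = ef
tr-EF ef (more t s) = step-EF (tr-EF ef t) s

tr-last : Tr G F₀ F Vis → F ∈ˡ Vis
tr-last begin      = here refl
tr-last (more _ _) = here refl

visited-EF : EF G F₀ → Tr G F₀ F Vis → F' ∈ˡ Vis → EF G F'
visited-EF ef begin      (here refl) = ef
visited-EF ef (more t s) (here refl) = step-EF (tr-EF ef t) s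
visited-EF ef (more t s) (there m)   = visited-EF ef t m

even : {A : Set} → List A → Bool
even []       = true
even (_ ∷ xs) = not (even xs)

record Enumeration (G : Graph n) : Set where
  field
    {first last} : Forest n
    {visited}    : List (Forest n)
    first-EF     : EF G first
    increasing   : ∀ {u v} → Desc first u v → u ≤ᶠ v
    trace        : Tr G first last visited
    complete     : ∀ {F} → EF G F → F ∈ˡ visited
    stuck        : ∀ j i F → ¬ Good G visited last j i F

  last-EF : EF G last
  last-EF = tr-EF first-EF trace

-- Lifting a run from a graph to its extension by one vertex

module Lifting {n} {G G' : Graph n} {k : Fin n} (X : Extends G G' k) where
  open Extends X
  open Insertion X
  open Del

  private variable
    F⁺ T T₀ T₁ T'' : Forest n

  AtEnd : Bool → Forest n → Set
  AtEnd true  = Leaf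
  AtEnd false = Top

  -- `Vis'` is a union of whole fibres, so being unvisited means the same for a forest and for the
  -- one obtained by deleting `k`.
  Full : List (Forest n) → List (Forest n) → Set
  Full Vis Vis' = ∀ {T F} → EF G F → Fib F T → (T ∈ˡ Vis' → F ∈ˡ Vis) × (F ∈ˡ Vis → T ∈ˡ Vis')

  parent≢k : EF G F → lookup F j ≡ just i → i ≢ k × j ≢ k
  parent≢k ef e = (λ { refl → EF.parent⇒≢ ef e (≡-sym (below-k ef (parent-desc e))) })
                , (λ { refl → EF.parent⇒≢ ef e (above-k ef (parent-desc e)) })

  edge-del : EF G F → Fib F T → i ≢ k → j ≢ k → lookup T j ≡ just i → lookup F j ≡ just i
  edge-del {F = F} {i = i} {j = j} efF (ef , dl) x y e = parent⁻ (EF.rooted efF) (del⁺ dl x y (parent-desc e) , EF.parent⇒≢ ef e , up)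
    where
    up : ∀ w → Desc F w j → w ≢ j → Desc F w i
    up w wj w≢j with w ≟ k
    ... | yes refl = ⊥-elim (y (below-k efF wj))
    ... | no w≢k = del⁺ dl w≢k x (EF.above-parent ef e (del⁻ dl w≢k y wj) w≢j)

  -- An edge of `F` is lost only if `k` lies strictly between its ends. A leaf has nothing below it
  -- and a root nothing above it, so this does not happen at an end of a fibre.
  edge-ins : ∀ b → AtEnd b T → EF G F → Fib F T → lookup F j ≡ just i → lookup T j ≡ just i
  edge-ins {T} {F} {j} {i} b end efF (ef , dl) e with parent≢k efF e
  ... | x , y = parent⁻ (EF.rooted ef) (ij , EF.parent⇒≢ efF e , up b end)
    where
    ij : Desc T i j
    ij = del⁻ dl x y (parent-desc e)
    up : ∀ b → AtEnd b T → ∀ w → Desc T w j → w ≢ j → Desc T w i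
    up b end w wj w≢j with w ≟ k
    ... | no w≢k = del⁻ dl w≢k x (EF.above-parent efF e (del⁺ dl w≢k y wj) w≢j)
    up true end w wj w≢j | yes refl = ⊥-elim (y (end j wj))
    up false end w wj w≢j | yes refl with desc-chain wj ij
    ... | inj₁ ki = ki
    ... | inj₂ ik = ⊥-elim (x (end i ik))

  flip-del : EF G F → EF G F' → Fib F T → Fib F' T'' → i ≢ k → j ≢ k → Flip T i j T'' → Flip F i j F'
  flip-del {F} {F'} {T} {T''} {i} {j} ef ef' f f' x y fl = record
    { edge = edge-del ef f x y edge ; rev = del⁺ (proj₂ f') y x rev
    ; same = λ p q → go ef (proj₂ f) (proj₂ f') (same p q) ; same⁻ = λ p q → go ef' (proj₂ f') (proj₂ f) (same⁻ p q) }
    where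
    open Flip fl
    go : ∀ {A B C D u v} → EF G A → Del C A → Del D B → (Desc C u v → Desc D u v) → Desc A u v → Desc B u v
    go {u = u} {v} ef p q f d with u ≟ k | v ≟ k
    ... | yes refl | _ = subst (Desc _ k) (≡-sym (below-k ef d)) self
    ... | no _ | yes refl = subst (λ u → Desc _ u k) (≡-sym (above-k ef d)) self
    ... | no x | no y = del⁺ q x y (f (del⁻ p x y d))

  rot-del : EF G F → Fib F T → i ≢ k → j ≢ k → Rot G' T i j T'' → ∃ λ F' → EF G F' × Fib F' T'' × Rot G F i j F'
  rot-del efF f x y r with rot⇒flip (proj₁ f) r
  ... | ef'' , fl with del-exists ef''
  ...   | F' , ef' , dl' = F' , ef' , (ef'' , dl') , flip⇒rot efF ef' (flip-del efF ef' f (ef'' , dl') x y fl)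

  -- A move at `k` stays in the fibre of `F`, which is exhausted. Any good move therefore involves
  -- two vertices other than `k` and descends to `G`.
  good-del : EF G F → Fib F T → F ∈ˡ Vis → Full Vis Vis' → Good G' Vis' T j i T'' → ∃ λ F' → Good G Vis F j i F'
  good-del {F = F} {T} {Vis} {Vis'} {j = j} {i} {T''} efF f F∈ full (i<j , r , new) with j ≟ k | i ≟ k
  ... | yes refl | _ = ⊥-elim (new (proj₂ (full efF (moves-fib f r)) F∈))
  ... | no j≢k | yes refl = ⊥-elim (ℕ.<⇒≱ i<j (j≤k r))
    where
    j≤k : Rot G' T k j T'' ⊎ Rot G' T j k T'' → j ≤ᶠ k
    j≤k (inj₁ r) = proj₂ (edge-bound (proj₁ f) (proj₁ r))
    j≤k (inj₂ r) = proj₁ (edge-bound (proj₁ f) (proj₁ r))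
  ... | no j≢k | no i≢k with r
  ...   | inj₁ q = let (F' , ef' , f' , q') = rot-del efF f i≢k j≢k q in
                   F' , i<j , inj₁ q' , λ m → new (proj₂ (full ef' f') m)
  ...   | inj₂ q = let (F' , ef' , f' , q') = rot-del efF f j≢k i≢k q in
                   F' , i<j , inj₂ q' , λ m → new (proj₂ (full ef' f') m)

  rot-ins : ∀ b → AtEnd b T → EF G F → Fib F T → Rot G F i j F⁺ →
            ∃ λ T⁺ → Rot G' T i j T⁺ × Fib F⁺ T⁺ × AtEnd b T⁺
  rot-ins {T} {F} {i} {j} {F⁺} b end efF f r = finish (flip-exists (proj₁ f) (edge-ins b end efF f (proj₁ r)))
    where
    x = proj₁ (parent≢k efF (proj₁ r))
    y = proj₂ (parent≢k efF (proj₁ r))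
    end⁺ : ∀ {T⁺} → EF G' T⁺ → Flip T i j T⁺ → ∀ b → AtEnd b T → AtEnd b T⁺
    end⁺ ef⁺ fl true end v d = end v (Flip.same⁻ fl (x ∘ ≡-sym) (y ∘ ≡-sym) d)
    end⁺ ef⁺ fl false end u d with u ≟ i | u ≟ j
    ... | yes refl | _ = ⊥-elim (x (end i (flip-j⁻ (proj₁ f) ef⁺ fl (desc-trans (Flip.rev fl) d))))
    ... | no _ | yes refl = ⊥-elim (x (end i (flip-j⁻ (proj₁ f) ef⁺ fl d)))
    ... | no u≢i | no u≢j = end u (Flip.same⁻ fl u≢i u≢j d)
    finish : (∃ λ T⁺ → EF G' T⁺ × Flip T i j T⁺) → ∃ λ T⁺ → Rot G' T i j T⁺ × Fib F⁺ T⁺ × AtEnd b T⁺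
    finish (T⁺ , ef⁺ , fl) =
      let r⁺ = flip⇒rot (proj₁ f) ef⁺ fl
          (F* , ef* , f* , r*) = rot-del efF f x y r⁺
      in T⁺ , r⁺ , subst (λ F → Fib F T⁺) (rot-unique efF {F*} {F⁺} r* r) f* , end⁺ ef⁺ fl b end

  step-ins : ∀ b → AtEnd b T → EF G F → Fib F T → F ∈ˡ Vis → Full Vis Vis' → Step G Vis F F⁺ →
             ∃ λ T⁺ → Step G' Vis' T T⁺ × Fib F⁺ T⁺ × AtEnd b T⁺
  step-ins {T} {F} {F⁺ = F⁺} b end efF f F∈ full s@(j , i , (i<j , r , new) , max , uniq) with ins r
    where
    ins : Rot G F i j F⁺ ⊎ Rot G F j i F⁺ → ∃ λ T⁺ → (Rot G' T i j T⁺ ⊎ Rot G' T j i T⁺) × Fib F⁺ T⁺ × AtEnd b T⁺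
    ins (inj₁ r) = let (T⁺ , r⁺ , rest) = rot-ins {F⁺ = F⁺} b end efF f r in T⁺ , inj₁ r⁺ , rest
    ins (inj₂ r) = let (T⁺ , r⁺ , rest) = rot-ins {F⁺ = F⁺} b end efF f r in T⁺ , inj₂ r⁺ , rest
  ... | T⁺ , r⁺ , f⁺ , end⁺ = T⁺
      , (j , i , (i<j , r⁺ , λ m → new (proj₁ (full (step-EF efF s) f⁺) m))
        , (λ j' i' T'' g → max j' i' _ (proj₂ (good-del efF f F∈ full g)))
        , (λ i' T'' g → uniq i' _ (proj₂ (good-del efF f F∈ full g))))
      , f⁺ , end⁺

  module _ {F : Forest n} (efF : EF G F) (S : Sweep F) {Vis : List (Forest n)} (F∉ : ¬ (F ∈ˡ Vis)) where
    open Sweep S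

    Inv : Forest n → List (Forest n) → Set
    Inv T Vis' = ∀ {T₁ F₁} → EF G F₁ → Fib F₁ T₁ →
      (T₁ ∈ˡ Vis' → F₁ ∈ˡ Vis ⊎ (F₁ ≡ F × T ≼ T₁)) × (F₁ ∈ˡ Vis ⊎ (F₁ ≡ F × T ≼ T₁) → T₁ ∈ˡ Vis')

    -- While the fibre is unfinished, `k` is the largest vertex on any edge and can still move, and
    -- its moves with another partner lead back to visited forests. Algorithm R has no choice.
    sweep : ∀ m {T Vis'} (f : Fib F T) → μ (proj₁ f) ≤ⁿ m → Tr G' T₀ T Vis' → Inv T Vis' →
            ∃ λ T → ∃ λ Vis' → Tr G' T₀ T Vis' × Fib F T × End T × Full (F ∷ Vis) Vis'
    sweep m {T} {Vis'} f le tr inv with advance f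
    ... | inj₁ end = T , Vis' , tr , f , end , λ {T₁} {F₁} ef₁ f₁ →
          (λ m → case proj₁ (inv ef₁ f₁) m of λ { (inj₁ p) → there p ; (inj₂ (eq , _)) → here eq })
        , (λ { (there p) → proj₂ (inv ef₁ f₁) (inj₁ p)
             ; (here refl) → proj₂ (inv ef₁ f₁) (inj₂ (refl , ≼-end end f f₁)) })
    sweep zero f le tr inv | inj₂ (_ , _ , _ , _ , _ , lt , _) = ⊥-elim (ℕ.n≮0 (ℕ.<-≤-trans lt le))
    sweep (suc m) {T} {Vis'} f le tr inv | inj₂ (i , T⁺ , i<k , mv , ef⁺ , lt , ahead , keep , behind , others) =
      sweep m f⁺ (ℕ.≤-pred (ℕ.<-≤-trans lt le)) (more tr st) inv⁺
      where
      f⁺ : Fib F T⁺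
      f⁺ = ef⁺ , proj₂ (moves-fib f mv)
      bounded : ∀ j' i' T'' → Good G' Vis' T j' i' T'' → j' ≤ᶠ k
      bounded j' i' T'' (_ , inj₁ r , _) = proj₂ (edge-bound (proj₁ f) (proj₁ r))
      bounded j' i' T'' (_ , inj₂ r , _) = proj₁ (edge-bound (proj₁ f) (proj₁ r))
      only : ∀ i' T'' → Good G' Vis' T k i' T'' → i' ≡ i
      only i' T'' (_ , r , new) with others i' T'' r
      ... | inj₂ eq = eq
      ... | inj₁ p = ⊥-elim (new (proj₂ (inv efF (moves-fib f r)) (inj₂ (refl , p))))
      st : Step G' Vis' T T⁺
      st = k , i , (i<k , mv , λ m → [ F∉ , ahead ∘ proj₂ ] (proj₁ (inv efF f⁺) m)) , bounded , only
      inv⁺ : Inv T⁺ (T⁺ ∷ Vis')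
      inv⁺ {T₁} {F₁} ef₁ f₁ = to , from
        where
        to : T₁ ∈ˡ T⁺ ∷ Vis' → F₁ ∈ˡ Vis ⊎ (F₁ ≡ F × T⁺ ≼ T₁)
        to (here refl) = inj₂ (del-unique ef₁ efF (proj₂ f₁) (proj₂ f⁺) , ≼-refl)
        to (there m) with proj₁ (inv ef₁ f₁) m
        ... | inj₁ p = inj₁ p
        ... | inj₂ (refl , p) = inj₂ (refl , keep T₁ f₁ p)
        from : F₁ ∈ˡ Vis ⊎ (F₁ ≡ F × T⁺ ≼ T₁) → T₁ ∈ˡ T⁺ ∷ Vis'
        from (inj₁ p) = there (proj₂ (inv ef₁ f₁) (inj₁ p))
        from (inj₂ (refl , p)) with behind T₁ f₁ p
        ... | inj₁ eq = here eq
        ... | inj₂ q = there (proj₂ (inv ef₁ f₁) (inj₂ (refl , q)))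

  sweep-fibre : ∀ b {T} → EF G F → ¬ (F ∈ˡ Vis) → Full Vis Vis' → Fib F T → AtEnd b T → Tr G' T₀ T (T ∷ Vis') →
    ∃ λ T → ∃ λ Vis' → Tr G' T₀ T Vis' × Fib F T × AtEnd (not b) T × Full (F ∷ Vis) Vis'
  sweep-fibre {F = F} {Vis = Vis} {Vis' = Vis'} b {T} efF F∉ full f end tr = go b end
    where
    inv : (S : Sweep F) → (∀ T₁ → Fib F T₁ → Sweep._≼_ S T T₁ → T₁ ≡ T) → Inv efF S F∉ T (T ∷ Vis')
    inv S extreme {T₁} {F₁} ef₁ f₁ = to , from
      where
      open Sweep S
      to : T₁ ∈ˡ T ∷ Vis' → F₁ ∈ˡ Vis ⊎ (F₁ ≡ F × T ≼ T₁)
      to (here refl) = inj₂ (del-unique ef₁ efF (proj₂ f₁) (proj₂ f) , ≼-refl)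
      to (there m) = inj₁ (proj₁ (full ef₁ f₁) m)
      from : F₁ ∈ˡ Vis ⊎ (F₁ ≡ F × T ≼ T₁) → T₁ ∈ˡ T ∷ Vis'
      from (inj₁ p) = there (proj₂ (full ef₁ f₁) p)
      from (inj₂ (refl , p)) = here (extreme T₁ f₁ p)
    go : ∀ b → AtEnd b T → ∃ λ T → ∃ λ Vis' → Tr G' _ T Vis' × Fib F T × AtEnd (not b) T × Full (F ∷ Vis) Vis'
    go true lf = sweep efF S F∉ _ f ℕ.≤-refl tr (inv S λ T₁ f₁ p → fib-det f₁ f (leaf-max lf f f₁) p)
      where S = sweep-up efF
    go false tp = sweep efF S F∉ _ f ℕ.≤-refl tr (inv S λ T₁ f₁ p → fib-det f₁ f p (top-min tp))
      where S = sweep-down efF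

  -- Each forest of `G` costs one traversal of its fibre from end to end, and steps between fibres
  -- preserve the end. Starting from a leaf, `k` is thus a leaf again after an even number of fibres
  -- and a root after an odd number.
  trace-ins : EF G F₀ → Fib F₀ T₀ → Leaf T₀ → Tr G F₀ F Vis →
    ∃ λ T → ∃ λ Vis' → Tr G' T₀ T Vis' × Fib F T × AtEnd (even Vis) T × Full Vis Vis'
  trace-ins ef₀ f₀ lf begin = sweep-fibre true ef₀ (λ ()) (λ _ _ → (λ ()) , λ ()) f₀ lf begin
  trace-ins ef₀ f₀ lf (more {Vis = Vis} t s) with trace-ins ef₀ f₀ lf t
  ... | T , Vis' , tr , f , end , full with step-ins (even Vis) end (tr-EF ef₀ t) f (tr-last t) full s
  ...   | T⁺ , st , f⁺ , end⁺ = sweep-fibre (even Vis) (step-EF (tr-EF ef₀ t) s) (F∉ s) full f⁺ end⁺ (more tr st)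
    where
    F∉ : ∀ {F F'} → Step G Vis F F' → ¬ (F' ∈ˡ Vis)
    F∉ (_ , _ , (_ , _ , new) , _) = new

  -- When `k` is a leaf, its strict ancestors are the vertices above its neighbours, so they change
  -- exactly as the forest without `k` does.
  leaf-flip : EF G F → EF G F' → Fib F T → Fib F' T₁ → Leaf T → Leaf T₁ → Flip F i j F' → Flip T i j T₁
  leaf-flip {F} {F'} {T} {T₁} {i} {j} ef ef' f f₁ lf lf₁ fl = record
    { edge = edge-ins true lf ef f edge ; rev = del⁻ (proj₂ f₁) y x rev
    ; same = λ p q → go f f₁ lf lf₁ (same p q) ; same⁻ = λ p q → go f₁ f lf₁ lf (same⁻ p q) }
    where
    open Flip fl
    x = proj₁ (parent≢k ef edge)
    y = proj₂ (parent≢k ef edge)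
    go : ∀ {A B C D u v} → Fib A C → Fib B D → Leaf C → Leaf D → (∀ {v} → Desc A u v → Desc B u v) → Desc C u v → Desc D u v
    go {u = u} {v} p q lf lf' f d with u ≟ k | v ≟ k
    ... | yes refl | _ = subst (Desc _ k) (≡-sym (lf v d)) self
    ... | no x | no y = del⁻ (proj₂ q) x y (f (del⁺ (proj₂ p) x y d))
    ... | no x | yes refl with neighbour-below p d x
    ...   | w , kw , uw with EF.comp (proj₁ q) kw
    ...     | inj₁ kw' = ⊥-elim (Adj⇒≢ G' kw (≡-sym (lf' w kw')))
    ...     | inj₂ wk = desc-trans (del⁻ (proj₂ q) x (Adj⇒≢ G' (Adj-sym G' kw)) (f uw)) wk

  record Extension (E : Enumeration G) : Set where
    private module E = Enumeration E
    field
      enum : Enumeration G'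
    open Enumeration enum public
    field
      first-fib  : Fib E.first first
      first-leaf : Leaf first
      last-fib   : Fib E.last last
      last-end   : AtEnd (even E.visited) last

  extend : (E : Enumeration G) → Extension E
  extend E with leaf-exists E.first-EF
    where module E = Enumeration E
  ... | T₀ , f₀ , lf , anc with trace-ins (Enumeration.first-EF E) f₀ lf (Enumeration.trace E)
  ...   | T , Vis' , tr , f , end , full = record
    { enum = record
      { first-EF = proj₁ f₀ ; increasing = inc ; trace = tr
      ; complete = λ ef → let (F , efF , dl) = del-exists ef in proj₂ (full efF (ef , dl)) (E.complete efF)
      ; stuck = λ j i T'' g → E.stuck j i _ (proj₂ (good-del E.last-EF f (tr-last E.trace) full g)) }
    ; first-fib = f₀ ; first-leaf = lf ; last-fib = f ; last-end = end }
    where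
    module E = Enumeration E
    inc : Desc T₀ u v → u ≤ᶠ v
    inc {u} {v} d with u ≟ k | v ≟ k
    ... | yes refl | _ = ℕ.≤-reflexive (cong toℕ (≡-sym (lf v d)))
    ... | no x | no y = E.increasing (del⁺ (proj₂ f₀) x y d)
    ... | no x | yes refl = let (w , kw , uw) = anc x d in ℕ.≤-trans (E.increasing uw) (bound (Adj-sym G' kw))

  flip-extend : (E : Enumeration G) (E' : Extension E) → even (Enumeration.visited E) ≡ true →
    Flip (Enumeration.first E) i j (Enumeration.last E) → Flip (Extension.first E') i j (Extension.last E')
  flip-extend E E' ev = leaf-flip E.first-EF E.last-EF first-fib last-fib first-leaf (subst (λ b → AtEnd b _) ev last-end)
    where
    module E = Enumeration E
    open Extension E'

-- Parity of a list with a fixed-point-free involution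

module _ {A : Set} where

  private variable
    x y z : A
    xs : List A

  even-─ : (m : y ∈ˡ xs) → even (xs ─ m) ≡ not (even xs)
  even-─ {xs = _ ∷ xs} (here _)  = ≡-sym (not-involutive (even xs))
  even-─ {xs = _ ∷ xs} (there m) = cong not (even-─ m)

  ∈-─⁻ : (m : y ∈ˡ xs) → z ∈ˡ (xs ─ m) → z ∈ˡ xs
  ∈-─⁻ (here _)  p         = there p
  ∈-─⁻ (there m) (here e)  = here e
  ∈-─⁻ (there m) (there p) = there (∈-─⁻ m p)

  ∈-─⁺ : (m : y ∈ˡ xs) → z ∈ˡ xs → z ≢ y → z ∈ˡ (xs ─ m)
  ∈-─⁺ (here refl) (here e)  z≢y = ⊥-elim (z≢y e)
  ∈-─⁺ (here refl) (there p) z≢y = p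
  ∈-─⁺ (there m)   (here e)  z≢y = here e
  ∈-─⁺ (there m)   (there p) z≢y = there (∈-─⁺ m p z≢y)

  unique-─ : (m : y ∈ˡ xs) → Unique xs → Unique (xs ─ m)
  unique-─ (here _)  (_ ∷ U) = U
  unique-─ (there m) (a ∷ U) = ─⁺ m a ∷ unique-─ m U

  removed : (m : y ∈ˡ xs) → Unique xs → z ∈ˡ (xs ─ m) → z ≢ y
  removed (here refl) (a ∷ U) p         refl = lookupᴬ a p refl
  removed (there m)   (a ∷ U) (here e)  refl = lookupᴬ a m (≡-sym e)
  removed (there m)   (a ∷ U) (there p) eq   = removed m U p eq

  -- Delete the head together with its partner. Functionality and symmetry keep the rest closed
  -- under `R`, and the length drops by two.
  even-involution : (R : A → A → Set) → (∀ {x y} → R x y → x ≢ y) → (∀ {x y} → R x y → R y x) →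
    (∀ {x y z} → R x y → R x z → y ≡ z) → ∀ xs → Unique xs → (∀ {x} → x ∈ˡ xs → ∃ λ y → y ∈ˡ xs × R x y) →
    even xs ≡ true
  even-involution R irr sm fun xs = go (length xs) xs ℕ.≤-refl
    where
    go : ∀ m xs → length xs ≤ⁿ m → Unique xs → (∀ {x} → x ∈ˡ xs → ∃ λ y → y ∈ˡ xs × R x y) → even xs ≡ true
    go m [] le U cl = refl
    go (suc m) (x ∷ ys) (s≤s le) (a ∷ U) cl with cl (here refl)
    ... | y , here refl , r = ⊥-elim (irr r refl)
    ... | y , there y∈ , r = trans (≡-sym (even-─ y∈)) (go m (ys ─ y∈) shorter (unique-─ y∈ U) cl')
      where
      shorter : length (ys ─ y∈) ≤ⁿ m
      shorter = ℕ.≤-trans (ℕ.n≤1+n _) (subst (_≤ⁿ m) (length-removeAt′ ys (index y∈)) le)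
      cl' : ∀ {z} → z ∈ˡ (ys ─ y∈) → ∃ λ w → w ∈ˡ (ys ─ y∈) × R z w
      cl' {z} z∈ with cl (there (∈-─⁻ y∈ z∈))
      ... | w , here refl , q = ⊥-elim (removed y∈ U z∈ (fun (sm q) r))
      ... | w , there w∈ , q = w , ∈-─⁺ y∈ w∈ (λ { refl → lookupᴬ a (∈-─⁻ y∈ z∈) (fun (sm r) (sm q)) }) , q

visited-unique : Tr G F₀ F Vis → Unique Vis
visited-unique begin      = [] ∷ []
visited-unique (more t (_ , _ , (_ , _ , new) , _)) = ¬Any⇒All¬ _ new ∷ visited-unique t

-- Exchanging the first two removed vertices

TopOf : VSet n → Forest n → Fin n → Set
TopOf W F m = W m × (∀ v → W v → Desc F m v)

-- Take the highest member of `W` above some member. A walk inside `W` could leave its subtree only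
-- at a strict ancestor, and no strict ancestor belongs to `W`.
top-exists : EF G F → (∀ v → Dec (W v)) → ConnectedIn G W → ∃ W → ∃ (TopOf W F)
top-exists {n} {G} {F} {W} ef W? cn (w₀ , Ww₀) with highest (rooted w₀)
  where
  open EF ef
  highest : Rooted F v → (∃ λ m → W m × (∀ w → W w → Desc F w m → w ≡ m)) ⊎ (∀ w → W w → ¬ Desc F w v)
  highest {v} R with W? v
  highest {v} (root e) | no ¬Wv = inj₂ λ { w Ww self → ¬Wv Ww ; w Ww (below e' _) → nothing≢just e e' }
  highest {v} (root e) | yes Wv = inj₁ (v , Wv , λ { w Ww self → refl ; w Ww (below e' _) → ⊥-elim (nothing≢just e e') })
  highest {v} (child e R) | d with highest R | d
  ... | inj₁ p | _ = inj₁ p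
  ... | inj₂ none | no ¬Wv = inj₂ λ
        { w Ww self → ¬Wv Ww ; w Ww (below e' d) → none w Ww (subst (Desc F w) (just-unique e' e) d) }
  ... | inj₂ none | yes Wv = inj₁ (v , Wv , λ
        { w Ww self → refl ; w Ww (below e' d) → ⊥-elim (none w Ww (subst (Desc F w) (just-unique e' e) d)) })
... | inj₂ none = ⊥-elim (none w₀ Ww₀ self)
... | inj₁ (m , Wm , max) = m , Wm , λ v Wv → reach-closed (Desc F m) self closed (cn m v Wm Wv)
  where
  closed : ∀ {a b} → Desc F m a → W a → W b → Adj G a b → Desc F m b
  closed {a} {b} ma _ Wb ad with EF.comp ef ad
  ... | inj₁ ab = desc-trans ma ab
  ... | inj₂ ba with desc-chain ma ba
  ...   | inj₁ mb = mb
  ...   | inj₂ bm = subst (Desc F m) (≡-sym (max b Wb bm)) self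

top-unique : EF G F → TopOf W F u → TopOf W F v → u ≡ v
top-unique ef (Wu , f) (Wv , g) = EF.antisym ef (f _ Wv) (g _ Wu)

-- B is glued to the rest of W along its vertices outside A, of which there is at most one.
record Swappable (G : Graph n) (W : VSet n) : Set₁ where
  field
    A B    : VSet n
    A?     : ∀ v → Dec (A v)
    B?     : ∀ v → Dec (B v)
    A⊆B    : ∀ {v} → A v → B v
    B⊆W    : ∀ {v} → B v → W v
    apex   : ∀ {u v} → B u → ¬ A u → B v → ¬ A v → u ≡ v
    two    : ∃ λ a → ∃ λ b → A a × A b × a ≢ b
    A-conn : ConnectedIn G A
    B-conn : ConnectedIn G B
    A-cut  : ∀ a → A a → ConnectedIn G (A ∖₁ a)
    B-cut  : ∀ a → A a → ConnectedIn G (B ∖₁ a)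
    closed : ∀ {u v} → A u → W v → Adj G u v → B v

module _ (r t : Fin n) where
  abstract

    swapped : Fin n → Fin n
    swapped u with u ≟ r | u ≟ t
    ... | yes _ | _     = t
    ... | no _  | yes _ = r
    ... | no _  | no _  = u

    swapped-r : swapped r ≡ t
    swapped-r with r ≟ r | r ≟ t
    ... | yes _ | _ = refl
    ... | no ne | _ = ⊥-elim (ne refl)

    swapped-t : swapped t ≡ r
    swapped-t with t ≟ r | t ≟ t
    ... | yes e | _     = e
    ... | no _  | yes _ = refl
    ... | no _  | no ne = ⊥-elim (ne refl)

    swapped-other : u ≢ r → u ≢ t → swapped u ≡ u
    swapped-other {u} x y with u ≟ r | u ≟ t
    ... | yes e | _     = ⊥-elim (x e)
    ... | no _  | yes e = ⊥-elim (y e)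
    ... | no _  | no _  = refl

    swapped-involutive : ∀ u → swapped (swapped u) ≡ u
    swapped-involutive u with u ≟ r | u ≟ t
    ... | yes refl | _        = swapped-t
    ... | no _     | yes refl = swapped-r
    ... | no x     | no y     = swapped-other x y

abstract
  swapped-comm : ∀ (r t u : Fin n) → swapped r t u ≡ swapped t r u
  swapped-comm r t u with u ≟ r | u ≟ t
  ... | yes refl | yes refl = refl
  ... | yes _    | no _     = refl
  ... | no _     | yes _    = refl
  ... | no _     | no _     = refl

module _ {n} {G : Graph n} (S : Swappable G Defs.All) where
  open Swappable S

  module Swap {F : Forest n} (ef : EF G F) {r t : Fin n} (tr : TopOf A F r) (tt : TopOf (A ∖₁ r) F t) where
    open EF ef

    ρ : Fin n → Fin n
    ρ = swapped r t

    Ar : A r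
    Ar = proj₁ tr

    At : A t
    At = proj₁ (proj₁ tt)

    t≢r : t ≢ r
    t≢r = proj₂ (proj₁ tt)

    D : Fin n → Fin n → Set
    D u v = Desc F (ρ u) (ρ v)

    Comparable : Fin n → Fin n → Set
    Comparable u v = Desc F u v ⊎ Desc F v u

    rt : Desc F r t
    rt = proj₂ tr t At

    ¬tr : ¬ Desc F t r
    ¬tr d = t≢r (antisym d rt)

    -- For `w` outside `A`, consider the top of `B`. If it lies in `A`, then `r` is above it and
    -- hence above `w`; otherwise it is the only vertex of `B` outside `A`, namely `w`, which is
    -- thus above `r`.
    r-comparable : B w → Comparable r w
    r-comparable {w} Bw with A? w
    ... | yes Aw = inj₁ (proj₂ tr w Aw)
    ... | no ¬Aw with top-exists ef B? B-conn (r , A⊆B Ar)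
    ...   | b , Bb , f with A? b
    ...     | yes Ab = inj₁ (desc-trans (proj₂ tr b Ab) (f w Bw))
    ...     | no ¬Ab = inj₂ (subst (λ z → Desc F z r) (apex Bb ¬Ab Bw ¬Aw) (f r (A⊆B Ar)))

    -- `t` heads `A` without `r`, so the argument for `r` repeats in `B` without `r`, which is
    -- connected by `B-cut`.
    t-comparable : B w → Comparable t w
    t-comparable {w} Bw with w ≟ r
    ... | yes refl = inj₂ rt
    ... | no w≢r with A? w
    ...   | yes Aw = inj₁ (proj₂ tt w (Aw , w≢r))
    ...   | no ¬Aw with top-exists ef (∖? B? r) (B-cut r Ar) (t , A⊆B At , t≢r)
    ...     | b , (Bb , b≢r) , f with A? b
    ...       | yes Ab = inj₁ (desc-trans (proj₂ tt b (Ab , b≢r)) (f w (Bw , w≢r)))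
    ...       | no ¬Ab = inj₂ (subst (λ z → Desc F z t) (apex Bb ¬Ab Bw ¬Aw) (f t (A⊆B At , t≢r)))

    comp-r : Adj G r v → Comparable (ρ r) (ρ v)
    comp-r {v} a with v ≟ t
    ... | yes refl rewrite swapped-r r t | swapped-t r t = inj₂ rt
    ... | no v≢t rewrite swapped-r r t | swapped-other r t (Adj⇒≢ G a ∘ ≡-sym) v≢t = t-comparable (closed Ar _ a)

    comp-t : Adj G t v → Comparable (ρ t) (ρ v)
    comp-t {v} a with v ≟ r
    ... | yes refl rewrite swapped-r r t | swapped-t r t = inj₁ rt
    ... | no v≢r rewrite swapped-t r t | swapped-other r t v≢r (Adj⇒≢ G a ∘ ≡-sym) = r-comparable (closed At _ a)

    D-comp : Adj G u v → D u v ⊎ D v u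
    D-comp {u} {v} a with u ≟ r | u ≟ t | v ≟ r | v ≟ t
    ... | yes refl | _ | _ | _ = comp-r a
    ... | no _ | yes refl | _ | _ = comp-t a
    ... | no _ | no _ | yes refl | _ = swap (comp-r (Adj-sym G a))
    ... | no _ | no _ | no _ | yes refl = swap (comp-t (Adj-sym G a))
    ... | no x | no y | no x' | no y' rewrite swapped-other r t x y | swapped-other r t x' y' = comp a

    -- The subtree of a vertex lying above t but not above r, with t replaced by r.
    module Exchange (w : Fin n) (wt : Desc F w t) (¬wr : ¬ Desc F w r) where

      Z : VSet n
      Z v = Desc F w (ρ v)

      Zr : Z r
      Zr rewrite swapped-r r t = wt

      Z-other : v ≢ r → v ≢ t → Desc F w v → Z v
      Z-other x y d rewrite swapped-other r t x y = d

      Z⇒≢t : Z v → v ≢ t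
      Z⇒≢t d refl rewrite swapped-t r t = ¬wr d

      Z⇒desc : Z v → v ≢ r → Desc F w v
      Z⇒desc {v} d x with v ≟ t
      ... | yes refl = wt
      ... | no y rewrite swapped-other r t x y = d

      A∖t⊆Z : (A ∖₁ t) v → Z v
      A∖t⊆Z {v} (Av , v≢t) with v ≟ r
      ... | yes refl = Zr
      ... | no v≢r = Z-other v≢r v≢t (desc-trans wt (proj₂ tt v (Av , v≢r)))

      -- Walking from v ∉ A to t inside the subtree, A can only be entered through B ∖ A.
      exit : Reach G (Desc F w) v t → Z v → ¬ A v → ∃ λ b → B b × ¬ A b × Desc F w b × Reach G Z v b
      exit (here _) Zv ¬Av = ⊥-elim (¬Av At)
      exit {v} (step {v = z} wv a rest) Zv ¬Av with A? z
      ... | yes Az = v , closed Az _ (Adj-sym G a) , ¬Av , wv , here Zv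
      ... | no ¬Az with exit rest (Z-other (λ { refl → ¬Az Ar }) (λ { refl → ¬Az At }) (reach-source rest)) ¬Az
      ...   | b , Bb , ¬Ab , wb , p = b , Bb , ¬Ab , wb , step Zv a p

      -- All of `A` except `t` lies in `Z`, so `A-cut` joins its vertices to `r`. From outside `A`,
      -- `exit` reaches the vertex `b` of `B` outside `A`. Then all of `B` except `t` lies in `Z`,
      -- and `B-cut` finishes the walk.
      to-r : Z v → Reach G Z v r
      to-r {v} Zv with A? v
      ... | yes Av = reach-mono A∖t⊆Z (A-cut t At v r (Av , Z⇒≢t Zv) (Ar , t≢r ∘ ≡-sym))
      ... | no ¬Av with exit (reach-trans (reach-sym (conn (Z⇒desc Zv v≢r))) (conn wt)) Zv ¬Av
        where
        v≢r : v ≢ r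
        v≢r refl = ¬Av Ar
      ...   | b , Bb , ¬Ab , wb , p = reach-trans p (reach-mono B∖t⊆Z
                (B-cut t At b r (Bb , λ { refl → ¬Ab At }) (A⊆B Ar , t≢r ∘ ≡-sym)))
        where
        B∖t⊆Z : ∀ {z} → (B ∖₁ t) z → Z z
        B∖t⊆Z {z} (Bz , z≢t) with A? z
        ... | yes Az = A∖t⊆Z (Az , z≢t)
        ... | no ¬Az with apex Bz ¬Az Bb ¬Ab
        ...   | refl = Z-other (λ { refl → ¬Az Ar }) z≢t wb

      connected : Z u → Z v → Reach G Z u v
      connected p q = reach-trans (to-r p) (reach-sym (to-r q))

    unchanged⁺ : (Desc F w r → Desc F w t) → (Desc F w t → Desc F w r) → Desc F w v → Desc F w (ρ v)
    unchanged⁺ {w} {v} f g d with v ≟ r | v ≟ t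
    ... | yes refl | _ = subst (Desc F w) (≡-sym (swapped-r r t)) (f d)
    ... | no _ | yes refl = subst (Desc F w) (≡-sym (swapped-t r t)) (g d)
    ... | no x | no y = subst (Desc F w) (≡-sym (swapped-other r t x y)) d

    subtree-conn : ∀ w → (Desc F w r → Desc F w t) → (Desc F w t → Desc F w r) →
                   Desc F w (ρ u) → Desc F w (ρ v) → Reach G (λ z → Desc F w (ρ z)) u v
    subtree-conn {u} {v} w f g p q = reach-mono (unchanged⁺ f g) (reach-trans (reach-sym (conn (back p))) (conn (back q)))
      where
      back : ∀ {z} → Desc F w (ρ z) → Desc F w z
      back {z} d = subst (Desc F w) (swapped-involutive r t z) (unchanged⁺ f g d)

    D-conn : D u v → Reach G (D u) u v
    D-conn {u} {v} d with dec (ρ u) r | dec (ρ u) t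
    ... | yes p | yes q = subtree-conn (ρ u) (λ _ → q) (λ _ → p) self d
    ... | yes p | no ¬q = ⊥-elim (¬q (desc-trans p rt))
    ... | no ¬p | no ¬q = subtree-conn (ρ u) (⊥-elim ∘ ¬p) (⊥-elim ∘ ¬q) self d
    -- This is the only case in which the descendant set of `ρ u` is not invariant under `ρ`.
    ... | no ¬p | yes q = Exchange.connected (ρ u) q ¬p self d

    realised : Realises G D
    realised = realise (record
      { D? = λ u v → dec (ρ u) (ρ v) ; D-refl = self ; D-trans = desc-trans
      ; D-anti = λ {u} {v} p q → trans (≡-sym (swapped-involutive r t u)) (trans (cong ρ (antisym p q)) (swapped-involutive r t v))
      ; D-chain = desc-chain ; D-comp = D-comp ; D-conn = D-conn })

  -- The involution as a relation. The two tops determine `r` and `t`, and the descendants then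
  -- determine `F'`.
  record Swaps (F F' : Forest n) : Set where
    field
      ef    : EF G F
      ef'   : EF G F'
      {r t} : Fin n
      top₁  : TopOf A F r
      top₂  : TopOf (A ∖₁ r) F t
      to    : ∀ {u v} → Desc F' u v → Desc F (swapped r t u) (swapped r t v)
      from  : ∀ {u v} → Desc F (swapped r t u) (swapped r t v) → Desc F' u v

  swaps-exists : EF G F → ∃ (Swaps F)
  swaps-exists {F} ef with two
  ... | a , b , Aa , Ab , a≢b with top-exists ef A? A-conn (a , Aa)
  ...   | r , tr with top-exists ef (∖? A? r) (A-cut r (proj₁ tr)) second
    where
    second : ∃ (A ∖₁ r)
    second with a ≟ r
    ... | yes refl = b , Ab , a≢b ∘ ≡-sym
    ... | no a≢r = a , Aa , a≢r
  ...     | t , tt = forest , record { ef = ef ; ef' = isEF ; top₁ = tr ; top₂ = tt ; to = to ; from = from }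
    where open Realises (Swap.realised ef tr tt)

  swaps-irrefl : Swaps F F' → F ≢ F'
  swaps-irrefl s refl = Swap.¬tr ef top₁ top₂ (from d)
    where
    open Swaps s
    d : Desc _ (swapped r t t) (swapped r t r)
    d rewrite swapped-r r t | swapped-t r t = proj₂ top₁ t (proj₁ (proj₁ top₂))

  -- In `F'` the vertex `t` is removed first among `A` and `r` second, so the roles of `r` and `t`
  -- interchange.
  swaps-sym : Swaps F F' → Swaps F' F
  swaps-sym {F} {F'} s = record
    { ef = ef' ; ef' = ef ; r = t ; t = r
    ; top₁ = At , (λ v Av → from (subst (λ z → Desc F z (ρ v)) (≡-sym (swapped-t r t)) (proj₂ top₁ _ (A-ρ Av))))
    ; top₂ = (Ar , t≢r ∘ ≡-sym) , (λ v (Av , v≢t) → from (subst (λ z → Desc F z (ρ v)) (≡-sym (swapped-r r t))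
               (proj₂ top₂ _ (A-ρ Av , λ eq → v≢t (trans (≡-sym (swapped-involutive r t v)) (trans (cong ρ eq) (swapped-r r t)))))))
    ; to = λ {u} {v} d → from (subst₂ (Desc F) (back u) (back v) d)
    ; from = λ {u} {v} d → subst₂ (Desc F) (≡-sym (back u)) (≡-sym (back v)) (to d) }
    where
    open Swaps s
    open Swap ef top₁ top₂ using (ρ; Ar; At; t≢r)
    A-ρ : A v → A (ρ v)
    A-ρ {v} Av with v ≟ r | v ≟ t
    ... | yes refl | _        = subst A (≡-sym (swapped-r r t)) At
    ... | no _     | yes refl = subst A (≡-sym (swapped-t r t)) Ar
    ... | no x     | no y     = subst A (≡-sym (swapped-other r t x y)) Av
    back : ∀ u → u ≡ ρ (swapped t r u)
    back u = ≡-sym (trans (cong ρ (swapped-comm t r u)) (swapped-involutive r t u))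

  swaps-functional : ∀ {F₁ F₂} → Swaps F F₁ → Swaps F F₂ → F₁ ≡ F₂
  swaps-functional s s' with top-unique (Swaps.ef s) (Swaps.top₁ s) (Swaps.top₁ s')
  ... | refl with top-unique (Swaps.ef s) (Swaps.top₂ s) (Swaps.top₂ s')
  ...   | refl = desc-ext (EF.rooted (Swaps.ef' s)) (EF.rooted (Swaps.ef' s'))
                   (λ d → Swaps.from s' (Swaps.to s d)) (λ d → Swaps.from s (Swaps.to s' d))

  even-visited : (E : Enumeration G) → even (Enumeration.visited E) ≡ true
  even-visited E = even-involution Swaps swaps-irrefl swaps-sym swaps-functional visited (visited-unique trace)
    (λ F∈ → let (F' , s) = swaps-exists (visited-EF first-EF trace F∈) in F' , complete (Swaps.ef' s) , s)
    where open Enumeration E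

-- Runs are deterministic

-- The rest of a fixed run up to its final state. Traces grow at the end, whereas two runs are
-- compared from their common start; this form lets one be consumed as the other grows.
data Cont {n} (G : Graph n) (F* : Forest n) (Vis* : List (Forest n)) : Forest n → List (Forest n) → Set where
  done : Cont G F* Vis* F* Vis*
  cont : Step G Vis F F' → Cont G F* Vis* F' (F' ∷ Vis) → Cont G F* Vis* F Vis

tr⇒cont : Tr G F₀ F Vis → Cont G F* Vis* F Vis → Cont G F* Vis* F₀ (F₀ ∷ [])
tr⇒cont begin      c = c
tr⇒cont (more t s) c = tr⇒cont t (cont s c)

good-unique : EF G F → Good G Vis F j i F₁ → Good G Vis F j i F₂ → F₁ ≡ F₂
good-unique {F₁ = F₁} {F₂ = F₂} ef (_ , inj₁ r , _) (_ , inj₁ q , _) = rot-unique ef {F₁} {F₂} r q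
good-unique {F₁ = F₁} ef (_ , inj₁ r , _) (_ , inj₂ q , _) = ⊥-elim (rot-asym {F' = F₁} ef r (proj₁ q))
good-unique {F₁ = F₁} ef (_ , inj₂ r , _) (_ , inj₁ q , _) = ⊥-elim (rot-asym {F' = F₁} ef r (proj₁ q))
good-unique {F₁ = F₁} {F₂ = F₂} ef (_ , inj₂ r , _) (_ , inj₂ q , _) = rot-unique ef {F₁} {F₂} r q

step-unique : EF G F → Step G Vis F F₁ → Step G Vis F F₂ → F₁ ≡ F₂
step-unique {F₁ = F₁} {F₂ = F₂} ef (j , i , g , max , uniq) (j' , i' , g' , max' , uniq')
  with toℕ-injective (ℕ.≤-antisym (max' j i _ g) (max j' i' _ g'))
... | refl with uniq' i _ g
...   | refl = good-unique {F₁ = F₁} {F₂ = F₂} ef g g'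

terminal-no-step : Terminal G Vis F → ¬ Step G Vis F F'
terminal-no-step (inj₁ none) (j , i , g , _) = none j i _ g
terminal-no-step (inj₂ (j' , i₁ , i₂ , _ , _ , i₁≢i₂ , g₁ , g₂ , max')) (j , i , g , max , uniq)
  with toℕ-injective (ℕ.≤-antisym (max' j i _ g) (max j' i₁ _ g₁))
... | refl = i₁≢i₂ (trans (uniq i₁ _ g₁) (≡-sym (uniq i₂ _ g₂)))

IsF0-unique : IsF0 G F → IsF0 G F' → F ≡ F'
IsF0-unique p q = forest-≡
  (λ v u e → Equivalence.from (q v u) (Equivalence.to (p v u) e))
  (λ v u e → Equivalence.from (p v u) (Equivalence.to (q v u) e))

run-unique : Tr G F₀ F* Vis* → EF G F₀ → IsF0 G F₀ → Terminal G Vis* F* → Run G F' F → F' ≡ F₀ × F ≡ F*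
run-unique {G = G} {F₀ = F₀} {F* = F*} {Vis* = Vis*} tr ef₀ f0 tm (Vis , t , tm') with follow t
  where
  follow : ∀ {F' F Vis} → Trace G F' F Vis → F' ≡ F₀ × EF G F × Cont G F* Vis* F Vis
  follow {F'} (start f) with IsF0-unique {F = F'} {F' = F₀} f f0
  ... | refl = refl , ef₀ , tr⇒cont tr done
  follow (next {F' = F⁺} t s) with follow t
  ... | eq , ef , done = ⊥-elim (terminal-no-step {F' = F⁺} tm s)
  ... | eq , ef , cont {F' = F⁻} s' c with step-unique {F₁ = F⁺} {F₂ = F⁻} ef s s'
  ...   | refl = eq , step-EF ef s , c
... | eq , _ , done = eq , refl
... | eq , _ , cont {F' = F⁻} s _ = ⊥-elim (terminal-no-step {F' = F⁻} tm' s)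

tr⇒trace : IsF0 G F₀ → Tr G F₀ F Vis → Trace G F₀ F Vis
tr⇒trace f0 begin      = start f0
tr⇒trace f0 (more t s) = next (tr⇒trace f0 t) s

-- The subtree of `u` is the component of `u` among the labels at least `u`: a walk leaving it would
-- step to a strict ancestor of `u`, whose label is smaller.
increasing⇒IsF0 : EF G F → (∀ {u v} → Desc F u v → u ≤ᶠ v) → IsF0 G F
increasing⇒IsF0 {G = G} {F = F} ef inc v u = mk⇔ to from
  where
  open EF ef
  reach : ∀ {u v} → Desc F u v → Reach G (u ≤ᶠ_) u v
  reach d = reach-mono inc (conn d)

  desc : ∀ {u v} → Reach G (u ≤ᶠ_) u v → Desc F u v
  desc {u} = reach-closed (Desc F u) self closed
    where
    closed : ∀ {a b} → Desc F u a → u ≤ᶠ a → u ≤ᶠ b → Adj G a b → Desc F u b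
    closed {a} {b} ua _ u≤b ad with comp ad
    ... | inj₁ ab = desc-trans ua ab
    ... | inj₂ ba with desc-chain ua ba
    ...   | inj₁ ub = ub
    ...   | inj₂ bu with toℕ-injective (ℕ.≤-antisym u≤b (inc bu))
    ...     | refl = self

  to : lookup F v ≡ just u → ParentF0 G v u
  to e with parent⁺ rooted e
  ... | uv , u≢v , max = ℕ.≤∧≢⇒< (inc uv) (u≢v ∘ toℕ-injective) , reach uv
      , λ u' u'<v r → inc (max u' (desc r) λ { refl → ℕ.<-irrefl refl u'<v })

  from : ParentF0 G v u → lookup F v ≡ just u
  from (u<v , r , max) with desc r
  ... | self = ⊥-elim (ℕ.<-irrefl refl u<v)
  ... | below {u = p} e up = trans e (cong just (toℕ-injective (ℕ.≤-antisym p≤u (inc up))))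
    where
    p≤u : p ≤ᶠ u
    p≤u = max p (ℕ.≤∧≢⇒< (inc (parent-desc e)) (parent⇒≢ e ∘ toℕ-injective)) (reach (parent-desc e))

-- Prefix graphs

-- A property rather than an equation with `cut`, so that `H` itself counts as its prefix of length
-- `n`.
record CutOf (H : Graph n) (m : ℕ) (G : Graph n) : Set where
  field
    cut⁻ : ∀ {u v} → Adj G u v → Adj H u v × toℕ u <ⁿ m × toℕ v <ⁿ m
    cut⁺ : ∀ {u v} → Adj H u v → toℕ u <ⁿ m → toℕ v <ⁿ m → Adj G u v

cut : ℕ → Graph n → Graph n
cut m H = record
  { E = λ u v → does (edge? u v)
  ; sym = λ u v → does-⇔ (mk⇔ (flipped u v) (flipped v u)) (edge? u v) (edge? v u)
  ; irrefl = λ v → dec-false (edge? v v) (λ p → Adj⇒≢ H (proj₁ p) refl) }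
  where
  edge? : ∀ u v → Dec (Adj H u v × toℕ u <ⁿ m × toℕ v <ⁿ m)
  edge? u v = adj? H u v ×-dec toℕ u ℕ.<? m ×-dec toℕ v ℕ.<? m
  flipped : ∀ u v → Adj H u v × toℕ u <ⁿ m × toℕ v <ⁿ m → Adj H v u × toℕ v <ⁿ m × toℕ u <ⁿ m
  flipped u v (a , p , q) = Adj-sym H a , q , p

cut-CutOf : ∀ m (H : Graph n) → CutOf H m (cut m H)
cut-CutOf m H = record
  { cut⁻ = λ {u} {v} a → does⇒ (adj? H u v ×-dec toℕ u ℕ.<? m ×-dec toℕ v ℕ.<? m) a
  ; cut⁺ = λ {u} {v} a p q → dec-true (adj? H u v ×-dec toℕ u ℕ.<? m ×-dec toℕ v ℕ.<? m) (a , p , q) }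
  where
  does⇒ : {P : Set} (d : Dec P) → does d ≡ true → P
  does⇒ (yes p) _ = p

prefix-extends : IsPEO H → CutOf H (toℕ k) G → CutOf H (suc (toℕ k)) G' → Extends G G' k
prefix-extends {H = H} {k = k} peo c c' = record
  { old = λ a → let (h , p , q) = cut⁻ c a in cut⁺ c' h (ℕ.m<n⇒m<1+n p) (ℕ.m<n⇒m<1+n q)
  ; fresh = λ a → λ { refl → ℕ.<-irrefl refl (proj₁ (proj₂ (cut⁻ c a))) }
  ; new = λ a x y → let (h , p , q) = cut⁻ c' a in cut⁺ c h (lt p x) (lt q y)
  ; clique = λ a b u≢v → let (h , _ , p) = cut⁻ c' a ; (h' , _ , q) = cut⁻ c' b in
      cut⁺ c' (peo k _ _ (lt p (Adj⇒≢ H h ∘ ≡-sym)) (lt q (Adj⇒≢ H h' ∘ ≡-sym)) h h' u≢v) p q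
  ; bound = λ a → ℕ.≤-pred (proj₁ (proj₂ (cut⁻ c' a))) }
  where
  open CutOf
  lt : toℕ u <ⁿ suc (toℕ k) → u ≢ k → toℕ u <ⁿ toℕ k
  lt p x = ℕ.≤∧≢⇒< (ℕ.≤-pred p) (x ∘ toℕ-injective)

edgeless-desc : (∀ {u v} → ¬ Adj G u v) → EF G F → Desc F u v → u ≡ v
edgeless-desc no-edge ef d with EF.conn ef d
... | here _     = refl
... | step _ a _ = ⊥-elim (no-edge a)

edgeless-unique : (∀ {u v} → ¬ Adj G u v) → EF G F → EF G F' → F ≡ F'
edgeless-unique no-edge ef ef' = desc-ext (EF.rooted ef) (EF.rooted ef')
  (λ d → subst (Desc _ _) (edgeless-desc no-edge ef d) self)
  (λ d → subst (Desc _ _) (edgeless-desc no-edge ef' d) self)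

edgeless-enumeration : {G : Graph n} → (∀ {u v} → ¬ Adj G u v) → Enumeration G
edgeless-enumeration {n} {G} no-edge = record
  { first-EF = ef ; increasing = λ d → ℕ.≤-reflexive (cong toℕ (edgeless-desc no-edge ef d)) ; trace = begin
  ; complete = λ ef' → here (edgeless-unique no-edge ef' ef)
  ; stuck = λ { j i F (_ , inj₁ r , _) → bare (proj₁ r) ; j i F (_ , inj₂ r , _) → bare (proj₁ r) } }
  where
  empty : Forest n
  empty = replicate n nothing
  bare : lookup empty v ≢ just u
  bare {v} = nothing≢just (lookup-replicate v nothing)
  ef : EF G empty
  ef = record
    { rooted = λ v → root (lookup-replicate v nothing) ; comp = λ a → ⊥-elim (no-edge a)
    ; conn = λ { self → here self ; (below e _) → ⊥-elim (bare e) } }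

-- All elimination forests of an edgeless graph coincide, so no step to an unvisited one exists and
-- the count is one.
edgeless-odd : (∀ {u v} → ¬ Adj G u v) → (E : Enumeration G) → even (Enumeration.visited E) ≡ false
edgeless-odd {G = G} no-edge E = go (Enumeration.first-EF E) (Enumeration.trace E)
  where
  go : ∀ {F₀ F Vis} → EF G F₀ → Tr G F₀ F Vis → even Vis ≡ false
  go ef begin = refl
  go ef (more t s@(_ , _ , (_ , _ , new) , _)) =
    ⊥-elim (new (subst (_∈ˡ _) (edgeless-unique no-edge (tr-EF ef t) (step-EF (tr-EF ef t) s)) (tr-last t)))

-- The run along the prefixes of a perfect elimination ordering

module _ {n} (H : Graph n) (peo : IsPEO H) {a b : Fin n} (a≡0 : toℕ a ≡ 0) (b≡1 : toℕ b ≡ 1) (ab : Adj H a b)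
         (swappable : ∀ (k : Fin n) → 2 ≤ⁿ toℕ k → Swappable H (_<ᶠ k)) where
  open CutOf

  -- At the start `b` is a leaf, hence below its neighbour `a`. The count over the edgeless `G` is
  -- odd, so `b` stops as a root and `a` is below it; all other vertices are isolated.
  first-edge : CutOf H 1 G → (X : Extends G G' b) → CutOf H 2 G' → (E : Enumeration G) (E' : Lifting.Extension X E) →
    Flip (Lifting.Extension.first E') a b (Lifting.Extension.last E')
  first-edge {G} {G'} c X c' E E' = record
    { edge = parent⁻ (EF.rooted (proj₁ first-fib)) (first-ab , a≢b , up)
    ; rev = last-ba
    ; same = λ x y d → subst (Desc _ _) (isolated (proj₁ first-fib) x y d) self
    ; same⁻ = λ x y d → subst (Desc _ _) (isolated (proj₁ last-fib) x y d) self }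
    where
    open Lifting X
    open Insertion X
    open Extension E'

    a≢b : a ≢ b
    a≢b = Adj⇒≢ H ab

    no-edge : ¬ Adj G u v
    no-edge e = let (h , p , q) = cut⁻ c e in
      Adj⇒≢ H h (toℕ-injective (trans (ℕ.n<1⇒n≡0 p) (≡-sym (ℕ.n<1⇒n≡0 q))))

    below-2 : toℕ u <ⁿ 2 → u ≢ b → u ≡ a
    below-2 lt u≢b = toℕ-injective (trans (ℕ.n<1⇒n≡0 (ℕ.≤∧≢⇒< (ℕ.≤-pred lt) (λ eq → u≢b (toℕ-injective (trans eq (≡-sym b≡1)))))) (≡-sym a≡0))

    edge' : Adj G' a b
    edge' = cut⁺ c' ab (subst (_<ⁿ 2) (≡-sym a≡0) (s≤s z≤n)) (subst (_<ⁿ 2) (≡-sym b≡1) ℕ.≤-refl)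

    isolated : ∀ {T u v} → EF G' T → u ≢ a → u ≢ b → Desc T u v → u ≡ v
    isolated ef x y d with EF.conn ef d
    ... | here _     = refl
    ... | step _ e _ = ⊥-elim (x (below-2 (proj₁ (proj₂ (cut⁻ c' e))) y))

    first-ab : Desc first a b
    first-ab with EF.comp (proj₁ first-fib) edge'
    ... | inj₁ d = d
    ... | inj₂ d = ⊥-elim (a≢b (first-leaf a d))

    last-ba : Desc last b a
    last-ba with EF.comp (proj₁ last-fib) edge'
    ... | inj₂ d = d
    ... | inj₁ d = ⊥-elim (a≢b (subst (λ e → AtEnd e last) (edgeless-odd no-edge E) last-end a d))

    up : ∀ w → Desc first w b → w ≢ b → Desc first w a
    up w d w≢b with neighbour-below first-fib d w≢b
    ... | z , bz , wz with edgeless-desc no-edge (Enumeration.first-EF E) wz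
    ...   | refl with below-2 (proj₂ (proj₂ (cut⁻ c' bz))) w≢b
    ...     | refl = self

  cut-swappable : ∀ (k : Fin n) → 2 ≤ⁿ toℕ k → CutOf H (toℕ k) G → Swappable G Defs.All
  cut-swappable {G} k le c = record
    { A = A ; B = B ; A? = A? ; B? = B? ; A⊆B = A⊆B ; B⊆W = _ ; apex = apex ; two = two
    ; A-conn = λ u v p q → via (B⊆W ∘ A⊆B) (A-conn u v p q)
    ; B-conn = λ u v p q → via B⊆W (B-conn u v p q)
    ; A-cut = λ x Ax u v p q → via (B⊆W ∘ A⊆B ∘ proj₁) (A-cut x Ax u v p q)
    ; B-cut = λ x Ax u v p q → via (B⊆W ∘ proj₁) (B-cut x Ax u v p q)
    ; closed = λ Au _ e → let (h , _ , q) = cut⁻ c e in closed Au q h }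
    where
    open Swappable (swappable k le)
    via : ∀ {W : VSet n} {u v} → (∀ {v} → W v → v <ᶠ k) → Reach H W u v → Reach G W u v
    via f = reach-map (λ e p q → cut⁺ c e (f p) (f q)) id

  enumerate : ∀ m → m ≤ⁿ n → CutOf H m G → Σ (Enumeration G) λ E →
    2 ≤ⁿ m → Flip (Enumeration.first E) a b (Enumeration.last E)
  enumerate zero le c = edgeless-enumeration (λ e → ℕ.n≮0 (proj₁ (proj₂ (cut⁻ c e)))) , λ ()
  enumerate {G} (suc m) m<n c = enum , flip
    where
    κ : Fin n
    κ = fromℕ< m<n
    κ≡m : toℕ κ ≡ m
    κ≡m = toℕ-fromℕ< m<n
    En : Σ (Enumeration (cut m H)) λ E → 2 ≤ⁿ m → Flip (Enumeration.first E) a b (Enumeration.last E)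
    En = enumerate m (ℕ.<⇒≤ m<n) (cut-CutOf m H)
    cκ : CutOf H (toℕ κ) (cut m H)
    cκ = subst (λ m' → CutOf H m' (cut m H)) (≡-sym κ≡m) (cut-CutOf m H)
    c' : CutOf H (suc (toℕ κ)) G
    c' = subst (λ m → CutOf H (suc m) G) (≡-sym κ≡m) c
    X : Extends (cut m H) G κ
    X = prefix-extends peo cκ c'
    open Lifting X
    E' : Extension (proj₁ En)
    E' = extend (proj₁ En)
    open Extension E'
    flip-at : ∀ {j} (X : Extends (cut m H) G j) → j ≡ b → m ≡ 1 → (E' : Lifting.Extension X (proj₁ En)) →
              Flip (Lifting.Extension.first E') a b (Lifting.Extension.last E')
    flip-at X refl refl E' = first-edge (cut-CutOf 1 H) X c (proj₁ En) E'
    flip : 2 ≤ⁿ suc m → Flip first a b last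
    -- At length two the inserted vertex is `b` and the flip arises. Afterwards it is only carried
    -- along: the even count of the previous prefix makes the inserted vertex a leaf in both the
    -- first and the last forest.
    flip le with ℕ.m≤n⇒m<n∨m≡n le
    ... | inj₂ eq = flip-at X (toℕ-injective (trans κ≡m (trans (≡-sym (ℕ.suc-injective eq)) (≡-sym b≡1)))) (≡-sym (ℕ.suc-injective eq)) E'
    ... | inj₁ lt = flip-extend (proj₁ En) E'
          (even-visited (cut-swappable κ (subst (2 ≤ⁿ_) (≡-sym κ≡m) (ℕ.≤-pred lt)) cκ) (proj₁ En)) (proj₂ En (ℕ.≤-pred lt))

  rotation-run : (Σ (Forest n) λ F₀ → Σ (Forest n) λ F → Run H F₀ F)
    × (∀ F₀ F → Run H F₀ F → Σ (Fin n) λ p → Σ (Fin n) λ c → Rot H F₀ p c F)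
  rotation-run = (first , last , visited , tr⇒trace f0 trace , terminal) , unique
    where
    whole : CutOf H n H
    whole = record { cut⁻ = λ e → e , toℕ<n _ , toℕ<n _ ; cut⁺ = λ e _ _ → e }
    En : Σ (Enumeration H) λ E → 2 ≤ⁿ n → Flip (Enumeration.first E) a b (Enumeration.last E)
    En = enumerate n ℕ.≤-refl whole
    open Enumeration (proj₁ En)
    f0 : IsF0 H first
    f0 = increasing⇒IsF0 first-EF increasing
    terminal : Terminal H visited last
    terminal = inj₁ stuck
    fl : Flip first a b last
    fl = proj₂ En (subst (_<ⁿ n) b≡1 (toℕ<n b))
    unique : ∀ F₀ F → Run H F₀ F → Σ (Fin n) λ p → Σ (Fin n) λ c → Rot H F₀ p c F
    unique F₀ F run with run-unique trace first-EF f0 terminal run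
    ... | refl , refl = a , b , flip⇒rot first-EF last-EF fl

-- Simplicial vertices of chordal graphs

data Induced {n} (G : Graph n) : Fin n → List (Fin n) → Fin n → Set where
  one  : Induced G w [] w
  cons : Adj G u v → Allᴸ (λ z → u ≢ z × ¬ Adj G u z) ℓ → Induced G v ℓ w → Induced G u (v ∷ ℓ) w

-- `u` is attached to the last vertex of the path that it equals or is adjacent to; everything
-- beyond is far from `u`, so the new path is induced again.
shortcut : ∀ u → Induced G v ℓ w → Allᴸ (λ z → u ≢ z × ¬ Adj G u z) (v ∷ ℓ)
           ⊎ (∃ λ ℓ' → Induced G u ℓ' w × (∀ {P : VSet _} → Allᴸ P (v ∷ ℓ) → Allᴸ P ℓ'))
shortcut {G = G} {v = v} u one with u ≟ v | adj? G u v
... | yes refl | _     = inj₂ ([] , one , λ _ → [])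
... | no _     | yes a = inj₂ (_ , cons a [] one , id)
... | no u≢v   | no ¬a = inj₁ ((u≢v , ¬a) ∷ [])
shortcut {G = G} {v = v} u p@(cons _ _ q) with shortcut u q
... | inj₂ (ℓ' , r , f) = inj₂ (ℓ' , r , λ { (_ ∷ all) → f all })
... | inj₁ far with u ≟ v | adj? G u v
...   | yes refl | _     = inj₂ (_ , p , λ { (_ ∷ all) → all })
...   | no _     | yes a = inj₂ (_ , cons a far p , id)
...   | no u≢v   | no ¬a = inj₁ ((u≢v , ¬a) ∷ far)

induced-path : Reach G W u w → ∃ λ ℓ → Induced G u ℓ w × Allᴸ W (u ∷ ℓ)
induced-path (here Wu) = [] , one , Wu ∷ []
induced-path {u = u} (step Wu a r) with induced-path r
... | ℓ , p , all with shortcut u p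
...   | inj₁ ((_ , ¬a) ∷ _) = ⊥-elim (¬a a)
...   | inj₂ (ℓ' , q , f) = ℓ' , q , Wu ∷ f all

induced-adj : Induced G u ℓ w → ∀ i j → suc (toℕ i) ≡ toℕ j → Adj G (lookupᴸ (u ∷ ℓ) i) (lookupᴸ (u ∷ ℓ) j)
induced-adj (cons a _ p) zero (suc zero) eq = a
induced-adj (cons a _ p) (suc i) (suc j) eq = induced-adj p i j (ℕ.suc-injective eq)
induced-adj one zero zero ()

induced-far : Induced G u ℓ w → ∀ i j → i <ᶠ j → lookupᴸ (u ∷ ℓ) i ≢ lookupᴸ (u ∷ ℓ) j
              × (Adj G (lookupᴸ (u ∷ ℓ) i) (lookupᴸ (u ∷ ℓ) j) → suc (toℕ i) ≡ toℕ j)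
induced-far one zero zero ()
induced-far {G = G} (cons a all p) zero (suc zero) lt = Adj⇒≢ G a , λ _ → refl
induced-far (cons a all p) zero (suc (suc j)) lt =
  let (ne , ¬a) = lookupᴬ all (∈-lookup j) in ne , λ a → ⊥-elim (¬a a)
induced-far (cons a all p) (suc i) (suc j) (s≤s lt) = let (ne , f) = induced-far p i j lt in ne , cong suc ∘ f

induced-last : Induced G u ℓ w → ∀ i → toℕ i ≡ length ℓ → lookupᴸ (u ∷ ℓ) i ≡ w
induced-last one          zero    eq = refl
induced-last (cons a _ p) (suc i) eq = induced-last p i (ℕ.suc-injective eq)

module _ {n} {G : Graph n} (chordal : Chordal G) where

  -- An induced path between two neighbours of v that otherwise avoids the
  -- neighbourhood of v would close up to a chordless cycle through v.
  no-hole : ∀ {v s t} {Z : VSet n} → Adj G v s → Adj G v t → s ≢ t → ¬ Adj G s t →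
            (∀ {z} → Z z → z ≡ s ⊎ z ≡ t ⊎ (v ≢ z × ¬ Adj G v z)) → ¬ Reach G Z s t
  no-hole {v} {s} {t} {Z} vs vt s≢t ¬st split r = case induced-path r of λ
    { ([] , one , _) → s≢t refl
    ; (_ ∷ [] , cons a _ one , _) → ¬st a
    ; (x ∷ y ∷ ℓ , p , all) → hole (x ∷ y ∷ ℓ) (s≤s (s≤s z≤n)) p all }
    where
    hole : ∀ ℓ → 2 ≤ⁿ length ℓ → Induced G s ℓ t → Allᴸ Z (s ∷ ℓ) → ⊥
    hole ℓ len p all = chordless (chordal (length cyc) (s≤s (s≤s len)) (lookupᴸ cyc) (injective , _ , edges))
      where
      cyc = v ∷ s ∷ ℓ
      f = lookupᴸ (s ∷ ℓ)
      Zf : ∀ i → s ≡ f i ⊎ t ≡ f i ⊎ (v ≢ f i × ¬ Adj G v (f i))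
      Zf i with split (lookupᴬ all (∈-lookup i))
      ... | inj₁ eq = inj₁ (≡-sym eq)
      ... | inj₂ (inj₁ eq) = inj₂ (inj₁ (≡-sym eq))
      ... | inj₂ (inj₂ q) = inj₂ (inj₂ q)
      v≢f : ∀ i → v ≢ f i
      v≢f i eq with Zf i
      ... | inj₁ e = Adj⇒≢ G vs (trans eq (≡-sym e))
      ... | inj₂ (inj₁ e) = Adj⇒≢ G vt (trans eq (≡-sym e))
      ... | inj₂ (inj₂ (ne , _)) = ne eq
      f-injective : ∀ i j → f i ≡ f j → i ≡ j
      f-injective i j eq with <-cmp i j
      ... | tri< lt _ _ = ⊥-elim (proj₁ (induced-far p i j lt) eq)
      ... | tri≈ _ e _ = e
      ... | tri> _ _ gt = ⊥-elim (proj₁ (induced-far p j i gt) (≡-sym eq))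
      injective : ∀ {i j} → lookupᴸ cyc i ≡ lookupᴸ cyc j → i ≡ j
      injective {zero} {zero} eq = refl
      injective {zero} {suc j} eq = ⊥-elim (v≢f j eq)
      injective {suc i} {zero} eq = ⊥-elim (v≢f i (≡-sym eq))
      injective {suc i} {suc j} eq = cong suc (f-injective i j eq)
      edges : ∀ i j → Consec (length cyc) i j → Adj G (lookupᴸ cyc i) (lookupᴸ cyc j)
      edges zero (suc zero) (inj₁ eq) = vs
      edges (suc i) (suc j) (inj₁ eq) = induced-adj p i j (ℕ.suc-injective eq)
      edges (suc i) zero (inj₂ (eq , _)) =
        subst (λ z → Adj G z v) (≡-sym (induced-last p i (ℕ.suc-injective (ℕ.suc-injective eq)))) (Adj-sym G vt)
      end : Fin (length (s ∷ ℓ))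
      end = fromℕ (length ℓ)
      f-end : f end ≡ t
      f-end = induced-last p end (toℕ-fromℕ (length ℓ))
      near-v : ∀ j → Adj G v (f j) → Consec (length cyc) zero (suc j) ⊎ Consec (length cyc) (suc j) zero
      near-v j ad with Zf j
      ... | inj₁ eq = inj₁ (inj₁ (cong suc (cong toℕ (f-injective zero j eq))))
      ... | inj₂ (inj₁ eq) = inj₂ (inj₂ (cong (λ l → suc (suc l))
              (trans (cong toℕ (f-injective j end (trans (≡-sym eq) (≡-sym f-end)))) (toℕ-fromℕ (length ℓ))) , refl))
      ... | inj₂ (inj₂ (_ , ¬ad)) = ⊥-elim (¬ad ad)
      chordless : (Σ (Fin (length cyc)) λ i → Σ (Fin (length cyc)) λ j →
        i ≢ j × ¬ Consec (length cyc) i j × ¬ Consec (length cyc) j i × Adj G (lookupᴸ cyc i) (lookupᴸ cyc j)) → ⊥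
      chordless (zero , zero , ne , _) = ne refl
      chordless (zero , suc j , ne , ¬c , ¬c' , ad) = [ ¬c , ¬c' ] (near-v j ad)
      chordless (suc i , zero , ne , ¬c , ¬c' , ad) = [ ¬c' , ¬c ] (near-v i (Adj-sym G ad))
      chordless (suc i , suc j , ne , ¬c , ¬c' , ad) with <-cmp i j
      ... | tri< lt _ _ = ¬c (inj₁ (cong suc (proj₂ (induced-far p i j lt) ad)))
      ... | tri≈ _ eq _ = ne (cong suc eq)
      ... | tri> _ _ gt = ¬c' (inj₁ (cong suc (proj₂ (induced-far p j i gt) (Adj-sym G ad))))

  nonadjacent? : (∀ v → Dec (W v)) → Dec (∃ λ a → ∃ λ b → W a × W b × a ≢ b × ¬ Adj G a b)
  nonadjacent? W? = any? λ a → any? λ b → W? a ×-dec W? b ×-dec ¬? (a ≟ b) ×-dec ¬? (adj? G a b)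

  complete-simplicial : ¬ (∃ λ a → ∃ λ b → W a × W b × a ≢ b × ¬ Adj G a b) → ∀ v → SimplicialIn G W v
  complete-simplicial all v u w Wu Ww _ _ u≢w with adj? G u w
  ... | yes a = a
  ... | no ¬a = ⊥-elim (all (u , w , Wu , Ww , u≢w , ¬a))

  -- Dirac: let C be the component of w in W minus the closed neighbourhood of v, and S its
  -- neighbours. S is a clique by no-hole, so a simplicial vertex of C ∪ S can be found in C.
  dirac : (∀ v → Dec (W v)) → W v → W w → v ≢ w → ¬ Adj G v w →
          ∃ λ c → W c × SimplicialIn G W c × v ≢ c × ¬ Adj G v c
  dirac W? = go _ W? ℕ.≤-refl
    where
    go : ∀ m {W : VSet n} {v w} (W? : ∀ v → Dec (W v)) → ∣ subset W? ∣ ≤ⁿ m → W v → W w → v ≢ w → ¬ Adj G v w →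
         ∃ λ c → W c × SimplicialIn G W c × v ≢ c × ¬ Adj G v c
    go zero W? le Wv = ⊥-elim (ℕ.n≮0 (ℕ.<-≤-trans (subset-< (λ _ → no λ ()) W? ⊥-elim Wv id) le))
    go (suc m) {W} {v} {w} W? le Wv Ww v≢w ¬vw = search
      where
      Far C S W⁻ : VSet n
      Far z = W z × v ≢ z × ¬ Adj G v z
      C = Reach G Far w
      S z = W z × Adj G v z × ∃ λ c → C c × Adj G c z
      W⁻ z = C z ⊎ S z

      C? : ∀ z → Dec (C z)
      C? = reach? G (λ z → W? z ×-dec ¬? (v ≟ z) ×-dec ¬? (adj? G v z)) w
      W⁻? : ∀ z → Dec (W⁻ z)
      W⁻? z = C? z ⊎-dec (W? z ×-dec adj? G v z ×-dec any? (λ c → C? c ×-dec adj? G c z))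

      Cw : C w
      Cw = here (Ww , v≢w , ¬vw)

      smaller : ∣ subset W⁻? ∣ ≤ⁿ m
      smaller = ℕ.≤-pred (ℕ.<-≤-trans (subset-< W⁻? W? [ proj₁ ∘ reach-target , proj₁ ] Wv
        [ (λ r → proj₁ (proj₂ (reach-target r)) refl) , (λ q → Adj⇒≢ G (proj₁ (proj₂ q)) refl) ]) le)

      S-clique : ∀ {s t} → S s → S t → s ≢ t → Adj G s t
      S-clique {s} {t} (_ , vs , c , Cc , cs) (_ , vt , d , Cd , dt) s≢t with adj? G s t
      ... | yes a = a
      ... | no ¬a = ⊥-elim (no-hole {Z = λ z → z ≡ s ⊎ z ≡ t ⊎ Far z} vs vt s≢t ¬a
              (λ { (inj₁ e) → inj₁ e ; (inj₂ (inj₁ e)) → inj₂ (inj₁ e) ; (inj₂ (inj₂ (_ , q))) → inj₂ (inj₂ q) })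
              (step (inj₁ refl) (Adj-sym G cs)
                (reach-snoc (reach-mono (inj₂ ∘ inj₂) (reach-trans (reach-sym Cc) Cd)) dt (inj₂ (inj₁ refl)))))

      neighbour : ∀ {c z} → C c → W z → Adj G c z → W⁻ z
      neighbour {c} {z} Cc Wz cz with v ≟ z | adj? G v z
      ... | yes refl | _ = ⊥-elim (proj₂ (proj₂ (reach-target Cc)) (Adj-sym G cz))
      ... | no _ | yes vz = inj₂ (Wz , vz , c , Cc , cz)
      ... | no v≢z | no ¬vz = inj₁ (reach-snoc Cc cz (Wz , v≢z , ¬vz))

      found : ∀ {c} → C c → SimplicialIn G W⁻ c → ∃ λ c → W c × SimplicialIn G W c × v ≢ c × ¬ Adj G v c
      found {c} Cc simp = let (Wc , v≢c , ¬vc) = reach-target Cc in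
        c , Wc , (λ u w Wu Ww cu cw → simp u w (neighbour Cc Wu cu) (neighbour Cc Ww cw) cu cw) , v≢c , ¬vc

      search : ∃ λ c → W c × SimplicialIn G W c × v ≢ c × ¬ Adj G v c
      search with nonadjacent? W⁻?
      ... | no all = found Cw (complete-simplicial all w)
      ... | yes (a , b , Wa , Wb , a≢b , ¬ab) with go m W⁻? smaller Wa Wb a≢b ¬ab
      ...   | c , inj₁ Cc , simp , _ = found Cc simp
      ...   | c , inj₂ Sc , _ , a≢c , ¬ac with go m W⁻? smaller (inj₂ Sc) Wa (a≢c ∘ ≡-sym) (¬ac ∘ Adj-sym G)
      ...     | d , inj₁ Cd , simp , _ = found Cd simp
      ...     | d , inj₂ Sd , _ , c≢d , ¬cd = ⊥-elim (¬cd (S-clique Sc Sd c≢d))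

  -- If all vertices of `W` are pairwise adjacent, `v` itself serves. Otherwise `dirac`, applied
  -- twice, yields two different simplicial vertices, and `Q` contains at most one of them.
  simplicial-avoiding : {W Q : VSet n} {v : Fin n} → (∀ v → Dec (W v)) → (∀ v → Dec (Q v)) → (∀ {u v} → Q u → Q v → u ≡ v) →
                        W v → ¬ Q v → ∃ λ c → W c × ¬ Q c × SimplicialIn G W c
  simplicial-avoiding {v = v} W? Q? uniq Wv ¬Qv with nonadjacent? W?
  ... | no all = v , Wv , ¬Qv , complete-simplicial all v
  ... | yes (a , b , Wa , Wb , a≢b , ¬ab) with dirac W? Wa Wb a≢b ¬ab
  ...   | c , Wc , simp , a≢c , ¬ac with Q? c
  ...     | no ¬Qc = c , Wc , ¬Qc , simp
  ...     | yes Qc with dirac W? Wc Wa (a≢c ∘ ≡-sym) (¬ac ∘ Adj-sym G)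
  ...       | d , Wd , simp' , c≢d , _ = d , Wd , (λ Qd → c≢d (uniq Qc Qd)) , simp'

-- Vertex orderings

Member : Vec (Fin n) m → VSet n
Member ℓ v = ∃ λ i → lookup ℓ i ≡ v

-- The order is read from right to left: the head of the vector comes last.
data Ordering {n} (G : Graph n) : Vec (Fin n) m → Set₁ where
  pair : Adj G a b → Ordering G (b ∷ a ∷ [])
  add  : {ℓ : Vec (Fin n) m} → Ordering G ℓ → Swappable G (Member ℓ) → ¬ Member ℓ c → SimplicialIn G (Member ℓ) c →
         Ordering G (c ∷ ℓ)

record OrderingOf {n} (G : Graph n) (W : VSet n) : Set₁ where
  field
    {size}   : ℕ
    {vector} : Vec (Fin n) size
    ordering : Ordering G vector
    sound    : ∀ {v} → Member vector v → W v
    covers   : ∀ {v} → W v → Member vector v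

swappable-⊆ : (S : Swappable G W) → (∀ {v} → Swappable.B S v → W' v) →
              (∀ {u v} → Swappable.A S u → W' v → Adj G u v → Swappable.B S v) → Swappable G W'
swappable-⊆ S sub cl = record
  { A = A ; B = B ; A? = A? ; B? = B? ; A⊆B = A⊆B ; B⊆W = sub ; apex = apex ; two = two ; A-conn = A-conn
  ; B-conn = B-conn ; A-cut = A-cut ; B-cut = B-cut ; closed = cl }
  where open Swappable S

swappable-resp : (∀ {v} → W v → W' v) → (∀ {v} → W' v → W v) → Swappable G W → Swappable G W'
swappable-resp f g S = swappable-⊆ S (f ∘ B⊆W) (λ Au Wv → closed Au (g Wv))
  where open Swappable S

ordering-resp : (∀ {v} → W v → W' v) → (∀ {v} → W' v → W v) → OrderingOf G W → OrderingOf G W'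
ordering-resp f g O = record { ordering = ordering ; sound = f ∘ sound ; covers = covers ∘ g }
  where open OrderingOf O

ordering-add : (∀ v → Dec (W v)) → W c → SimplicialIn G W c → Swappable G (W ∖₁ c) → OrderingOf G (W ∖₁ c) → OrderingOf G W
ordering-add {W = W} {c = c} W? Wc simp S O = record
  { ordering = add ordering (swappable-resp covers sound S) (λ p → proj₂ (sound p) refl)
      (λ u w p q → simp u w (proj₁ (sound p)) (proj₁ (sound q)))
  ; sound = λ { (zero , refl) → Wc ; (suc i , eq) → proj₁ (sound (i , eq)) }
  ; covers = cov }
  where
  open OrderingOf O
  cov : W v → Member (c ∷ vector) v
  cov {v} Wv with v ≟ c
  ... | yes refl = zero , refl
  ... | no v≢c = let (i , eq) = covers (Wv , v≢c) in suc i , eq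

-- 2-connected graphs and single edges

Core : Graph n → VSet n → Set
Core G W = TwoConnectedIn G W ⊎ SingleEdgeIn G W

two-connected-conn : TwoConnectedIn G W → ConnectedIn G W
two-connected-conn {G = G} {W = W} ((a , b , c , Wa , Wb , Wc , a≢b , b≢c , a≢c) , cut) u v Wu Wv
  with third
  where
  third : ∃ λ z → W z × u ≢ z × v ≢ z
  third with u ≟ a | v ≟ a | u ≟ b | v ≟ b
  ... | no p | no q | _ | _ = a , Wa , p , q
  ... | yes _ | _ | no p | no q = b , Wb , p , q
  ... | yes refl | _ | yes refl | _ = ⊥-elim (a≢b refl)
  ... | yes refl | _ | no _ | yes refl = c , Wc , a≢c , b≢c
  ... | no _ | yes refl | yes refl | _ = c , Wc , b≢c , a≢c
  ... | no _ | yes refl | no _ | yes refl = ⊥-elim (a≢b refl)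
  ... | no _ | yes _ | no p | no q = b , Wb , p , q
... | z , Wz , u≢z , v≢z = reach-mono proj₁ (cut z Wz u v (Wu , u≢z) (Wv , v≢z))

edge-conn : SingleEdgeIn G W → ConnectedIn G W
edge-conn {G = G} (a , b , _ , ab , ends) u v Wu Wv with Equivalence.to (ends u) Wu | Equivalence.to (ends v) Wv
... | inj₁ refl | inj₁ refl = here Wu
... | inj₁ refl | inj₂ refl = step Wu ab (here Wv)
... | inj₂ refl | inj₁ refl = step Wu (Adj-sym G ab) (here Wv)
... | inj₂ refl | inj₂ refl = here Wu

core-conn : Core G W → ConnectedIn G W
core-conn (inj₁ t) = two-connected-conn t
core-conn (inj₂ s) = edge-conn s

core-cut : Core G W → ∀ x → W x → ConnectedIn G (W ∖₁ x)
core-cut (inj₁ (_ , cut)) = cut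
core-cut (inj₂ (a , b , _ , ab , ends)) x Wx u v (Wu , u≢x) (Wv , v≢x)
  with Equivalence.to (ends x) Wx | Equivalence.to (ends u) Wu | Equivalence.to (ends v) Wv
... | _ | inj₁ refl | inj₁ refl = here (Wu , u≢x)
... | _ | inj₂ refl | inj₂ refl = here (Wu , u≢x)
... | inj₁ refl | inj₁ refl | _ = ⊥-elim (u≢x refl)
... | inj₁ refl | _ | inj₁ refl = ⊥-elim (v≢x refl)
... | inj₂ refl | inj₂ refl | _ = ⊥-elim (u≢x refl)
... | inj₂ refl | _ | inj₂ refl = ⊥-elim (v≢x refl)

core-two : Core G W → ∃ λ a → ∃ λ b → W a × W b × a ≢ b
core-two (inj₁ ((a , b , _ , Wa , Wb , _ , a≢b , _) , _)) = a , b , Wa , Wb , a≢b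
core-two (inj₂ (a , b , a≢b , _ , ends)) =
  a , b , Equivalence.from (ends a) (inj₁ refl) , Equivalence.from (ends b) (inj₂ refl) , a≢b

core-swappable : (∀ v → Dec (W v)) → Core G W → Swappable G W
core-swappable W? cr = record
  { A? = W? ; B? = W? ; A⊆B = id ; B⊆W = id ; apex = λ Wu ¬Wu → ⊥-elim (¬Wu Wu) ; two = core-two cr
  ; A-conn = core-conn cr ; B-conn = core-conn cr ; A-cut = core-cut cr ; B-cut = core-cut cr ; closed = λ _ Wv _ → Wv }

-- Walks bypass the simplicial vertex `c`, so with three vertices left the graph stays 2-connected.
-- With only two left, connectivity makes them an edge.
core-remove : (∀ v → Dec (W v)) → TwoConnectedIn G W → W c → SimplicialIn G W c → Core G (W ∖₁ c)
core-remove {W = W} {G = G} {c = c} W? (three , cut) Wc simp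
  with pick three
  where
  pick : (Σ (Fin _) λ a → Σ (Fin _) λ b → Σ (Fin _) λ d → W a × W b × W d × a ≢ b × b ≢ d × a ≢ d) →
         ∃ λ p → ∃ λ q → (W ∖₁ c) p × (W ∖₁ c) q × p ≢ q
  pick (a , b , d , Wa , Wb , Wd , a≢b , b≢d , a≢d) with a ≟ c | b ≟ c
  ... | yes refl | _        = b , d , (Wb , a≢b ∘ ≡-sym) , (Wd , a≢d ∘ ≡-sym) , b≢d
  ... | no a≢c   | yes refl = a , d , (Wa , a≢c) , (Wd , b≢d ∘ ≡-sym) , a≢d
  ... | no a≢c   | no b≢c   = a , b , (Wa , a≢c) , (Wb , b≢c) , a≢b
... | p , q , Wp , Wq , p≢q with any? (λ r → ∖? W? c r ×-dec ¬? (p ≟ r) ×-dec ¬? (q ≟ r))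
...   | yes (r , Wr , p≢r , q≢r) = inj₁ ((p , q , r , Wp , Wq , Wr , p≢q , q≢r , p≢r) , λ x (Wx , x≢c) u v (Wu , u≢x) (Wv , v≢x) →
          reach-mono (λ ((Wz , z≢x) , z≢c) → (Wz , z≢c) , z≢x)
            (reach-avoid c (λ Wa Wb ca cb → simp _ _ (proj₁ Wa) (proj₁ Wb) ca cb)
              (cut x Wx u v (proj₁ Wu , u≢x) (proj₁ Wv , v≢x)) (proj₂ Wu) (proj₂ Wv)))
...   | no none = inj₂ (p , q , p≢q , pq , λ v → mk⇔ ends λ { (inj₁ refl) → Wp ; (inj₂ refl) → Wq })
  where
  ends : ∀ {v} → (W ∖₁ c) v → v ≡ p ⊎ v ≡ q
  ends {v} Wv with p ≟ v | q ≟ v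
  ... | yes eq | _ = inj₁ (≡-sym eq)
  ... | no _ | yes eq = inj₂ (≡-sym eq)
  ... | no p≢v | no q≢v = ⊥-elim (none (v , Wv , p≢v , q≢v))
  pq : Adj G p q
  pq with cut c Wc p q Wp Wq
  ... | here _ = ⊥-elim (p≢q refl)
  ... | step _ a r with ends (reach-source r)
  ...   | inj₁ refl = ⊥-elim (Adj⇒≢ G a refl)
  ...   | inj₂ refl = a

-- Reachability in `W'` is decidable, so a walk may be obtained under double negation, where members
-- of `W'` count as members of `W`.
two-connected-stable : (∀ v → Dec (W' v)) → (∀ {v} → W v → W' v) → (∀ {v} → W' v → ¬ ¬ W v) →
                       TwoConnectedIn G W → TwoConnectedIn G W'
two-connected-stable {G = G} P? sub stable ((a , b , c , Wa , Wb , Wc , ne) , cut) =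
  (a , b , c , sub Wa , sub Wb , sub Wc , ne) , λ x Px u v (Pu , u≢x) (Pv , v≢x) →
    decidable-stable (reach? G (∖? P? x) u v) λ ¬r →
      stable Px λ Wx → stable Pu λ Wu → stable Pv λ Wv →
        ¬r (reach-mono (λ (Wz , z≢x) → sub Wz , z≢x) (cut x Wx u v (Wu , u≢x) (Wv , v≢x)))

core-stable : (∀ v → Dec (W' v)) → (∀ {v} → W v → W' v) → (∀ {v} → W' v → ¬ ¬ W v) → Core G W → Core G W'
core-stable P? sub stable (inj₁ t) = inj₁ (two-connected-stable P? sub stable t)
core-stable P? sub stable (inj₂ (a , b , a≢b , ab , ends)) = inj₂ (a , b , a≢b , ab , λ v → mk⇔
  (λ Pv → decidable-stable (v ≟ a ⊎-dec v ≟ b) λ ¬e → stable Pv (¬e ∘ Equivalence.to (ends v)))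
  (sub ∘ Equivalence.from (ends v)))

-- Orderings from the hypotheses

module _ {n} {G : Graph n} (chordal : Chordal G) where

  core-ordering : (∀ v → Dec (W v)) → Core G W → OrderingOf G W
  core-ordering W? = go _ W? ℕ.≤-refl
    where
    go : ∀ m {W : VSet n} (W? : ∀ v → Dec (W v)) → ∣ subset W? ∣ ≤ⁿ m → Core G W → OrderingOf G W
    go m W? le (inj₂ (a , b , a≢b , ab , ends)) = record
      { ordering = pair ab
      ; sound = λ { (zero , refl) → Equivalence.from (ends b) (inj₂ refl) ; (suc zero , refl) → Equivalence.from (ends a) (inj₁ refl) }
      ; covers = λ {v} Wv → case Equivalence.to (ends v) Wv of λ { (inj₁ refl) → suc zero , refl ; (inj₂ refl) → zero , refl } }
    go m W? le (inj₁ t@((a , _ , _ , Wa , _) , _)) with simplicial-avoiding {G = G} chordal {Q = λ _ → ⊥} W? (λ _ → no id) (λ ()) Wa id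
    go zero W? le (inj₁ _) | c , Wc , _ , simp =
      ⊥-elim (ℕ.n≮0 (ℕ.<-≤-trans (subset-< (λ _ → no id) W? ⊥-elim Wc id) le))
    go (suc m) W? le (inj₁ t) | c , Wc , _ , simp =
      ordering-add W? Wc simp (core-swappable (∖? W? c) cr) (go m (∖? W? c) smaller cr)
      where
      cr = core-remove W? t Wc simp
      smaller = ℕ.≤-pred (ℕ.<-≤-trans (subset-< (∖? W? c) W? proj₁ Wc (λ q → proj₂ q refl)) le)

  -- Peel vertices off from the end. A simplicial vertex `c` of `V` minus `A`, chosen away from the
  -- at most one vertex of `B` outside `A`, lies outside `B`. It then has no neighbour in `A`, so it
  -- is simplicial in `V`.
  extend-ordering : (∀ v → Dec (W v)) → (S : Swappable G W) → OrderingOf G (Swappable.B S) → OrderingOf G W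
  extend-ordering {W} W? S O = go _ W? ℕ.≤-refl B⊆W id
    where
    open Swappable S
    go : ∀ m {V : VSet n} (V? : ∀ v → Dec (V v)) → ∣ subset V? ∣ ≤ⁿ m → (∀ {v} → B v → V v) → (∀ {v} → V v → W v) →
         OrderingOf G V
    go m V? le B⊆V V⊆W with any? (λ v → V? v ×-dec ¬? (B? v))
    ... | no none = ordering-resp B⊆V (λ {v} Vv → decidable-stable (B? v) λ ¬Bv → none (v , Vv , ¬Bv)) O
    go zero V? le B⊆V V⊆W | yes (v , Vv , _) =
      ⊥-elim (ℕ.n≮0 (ℕ.<-≤-trans (subset-< (λ _ → no id) V? ⊥-elim Vv id) le))
    go (suc m) {V} V? le B⊆V V⊆W | yes (v , Vv , ¬Bv)
      with simplicial-avoiding {G = G} chordal {Q = λ z → B z × ¬ A z} (λ z → V? z ×-dec ¬? (A? z)) (λ z → B? z ×-dec ¬? (A? z))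
             (λ (Bu , ¬Au) (Bv , ¬Av) → apex Bu ¬Au Bv ¬Av) (Vv , ¬Bv ∘ A⊆B) (¬Bv ∘ proj₁)
    ... | c , (Vc , ¬Ac) , ¬Qc , simp = ordering-add V? Vc
            (λ u w Vu Vw cu cw → simp u w (Vu , ¬A-nbr cu) (Vw , ¬A-nbr cw) cu cw)
            (swappable-⊆ S B⊆V∖c (λ Au (Vv , _) → closed Au (V⊆W Vv)))
            (go m (∖? V? c) (ℕ.≤-pred (ℕ.<-≤-trans (subset-< (∖? V? c) V? proj₁ Vc (λ q → proj₂ q refl)) le)) B⊆V∖c (V⊆W ∘ proj₁))
      where
      ¬Bc : ¬ B c
      ¬Bc Bc = ¬Qc (Bc , ¬Ac)
      ¬A-nbr : Adj G c u → ¬ A u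
      ¬A-nbr cu Au = ¬Bc (closed Au (V⊆W Vc) (Adj-sym G cu))
      B⊆V∖c : ∀ {z} → B z → (V ∖₁ c) z
      B⊆V∖c Bz = B⊆V Bz , λ { refl → ¬Bc Bz }

  isolated-edge-ordering : (∀ v → Dec (W v)) → IsolatedEdgeIn G W → Swappable G W × OrderingOf G W
  isolated-edge-ordering {W} W? (a , b , Wa , Wb , ab , onlyb , onlya) = S , extend-ordering W? S (core-ordering P? edge)
    where
    P : VSet n
    P v = v ≡ a ⊎ v ≡ b
    P? : ∀ v → Dec (P v)
    P? v = v ≟ a ⊎-dec v ≟ b
    edge : Core G P
    edge = inj₂ (a , b , Adj⇒≢ G ab , ab , λ v → mk⇔ id id)
    S : Swappable G W
    S = swappable-⊆ (core-swappable P? edge) (λ { (inj₁ refl) → Wa ; (inj₂ refl) → Wb })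
      (λ { (inj₁ refl) Wv e → inj₂ (onlyb _ Wv e) ; (inj₂ refl) Wv e → inj₁ (onlya _ Wv e) })

  -- The vertex set X of the appendix need not be decidable; up to double negation it is x together
  -- with the component of any other vertex of X in W minus x, which is.
  appendix-ordering : (∀ v → Dec (W v)) → HAppendixIn G W → Swappable G W × OrderingOf G W
  appendix-ordering {W} W? (X , x , X⊆W , Xx , X2 , X-x , _ , sep) with core-two X-x
  ... | a , _ , (Xa , a≢x) , _ = S , extend-ordering W? S (core-ordering P? (inj₁ P2))
    where
    P : VSet n
    P z = z ≡ x ⊎ Reach G (W ∖₁ x) a z
    P? : ∀ z → Dec (P z)
    P? z = z ≟ x ⊎-dec reach? G (∖? W? x) a z
    X⊆P : X v → P v
    X⊆P {v} Xv with v ≟ x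
    ... | yes eq = inj₁ eq
    ... | no v≢x = inj₂ (reach-mono (λ (Xz , z≢x) → X⊆W _ Xz , z≢x) (proj₂ X2 x Xx a v (Xa , a≢x) (Xv , v≢x)))
    stable : P v → ¬ ¬ X v
    stable (inj₁ refl) ¬Xv = ¬Xv Xx
    stable (inj₂ r) = reach-closed (λ z → ¬ ¬ X z) (λ ¬Xa → ¬Xa Xa)
      (λ ¬¬Xz (_ , z≢x) (Wy , _) zy ¬Xy → ¬¬Xz λ Xz → sep _ _ Xz z≢x Wy ¬Xy zy) r
    P2 : TwoConnectedIn G P
    P2 = two-connected-stable P? X⊆P stable X2
    P-x : Core G (P ∖₁ x)
    P-x = core-stable (∖? P? x) (λ (Xv , v≢x) → X⊆P Xv , v≢x) (λ (Pv , v≢x) ¬X → stable Pv λ Xv → ¬X (Xv , v≢x)) X-x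
    is-x : P v → ¬ (P ∖₁ x) v → v ≡ x
    is-x {v} Pv ¬A = decidable-stable (v ≟ x) λ v≢x → ¬A (Pv , v≢x)
    leave : (P ∖₁ x) u → W v → Adj G u v → P v
    leave (inj₁ eq , u≢x) Wv e = ⊥-elim (u≢x eq)
    leave {v = v} (inj₂ r , u≢x) Wv e with v ≟ x
    ... | yes eq = inj₁ eq
    ... | no v≢x = inj₂ (reach-snoc r e (Wv , v≢x))
    S : Swappable G W
    S = record
      { A = P ∖₁ x ; B = P ; A? = ∖? P? x ; B? = P? ; A⊆B = proj₁
      ; B⊆W = λ { (inj₁ refl) → X⊆W _ Xx ; (inj₂ r) → proj₁ (reach-target r) }
      ; apex = λ Pu ¬Au Pv ¬Av → trans (is-x Pu ¬Au) (≡-sym (is-x Pv ¬Av))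
      ; two = core-two P-x ; A-conn = core-conn P-x ; B-conn = two-connected-conn P2
      ; A-cut = core-cut P-x ; B-cut = λ z Az → proj₂ P2 z (proj₁ Az) ; closed = leave }

  ab-ordering : (∀ v → Dec (W v)) → CondABIn G W → Swappable G W × OrderingOf G W
  ab-ordering W? (inj₁ ap) = appendix-ordering W? ap
  ab-ordering W? (inj₂ (lift e)) = isolated-edge-ordering W? e

  hyp-ordering : Hyp G → OrderingOf G Defs.All
  hyp-ordering (inj₁ ab) = proj₂ (ab-ordering (λ _ → yes _) ab)
  -- With `y` last, `G - y` becomes a proper prefix. Hence its own exchange is required here as
  -- well, not just those of its prefixes.
  hyp-ordering (inj₂ (y , simp , rest)) = ordering-add (λ _ → yes _) _ simp (proj₁ below-y) (proj₂ below-y)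
    where
    -y? : ∀ v → Dec ((Defs.All ∖₁ y) v)
    -y? = ∖? (λ _ → yes _) y
    below-y : Swappable G (Defs.All ∖₁ y) × OrderingOf G (Defs.All ∖₁ y)
    below-y = [ ab-ordering -y? , (λ (lift (t , _)) → core-swappable -y? (inj₁ t) , core-ordering -y? (inj₁ t)) ] rest

-- From an ordering to a labelling

ordering-injective : {ℓ : Vec (Fin n) m} → Ordering G ℓ → ∀ i j → lookup ℓ i ≡ lookup ℓ j → i ≡ j
ordering-injective {G = G} (pair ab) zero (suc zero) eq = ⊥-elim (Adj⇒≢ G ab (≡-sym eq))
ordering-injective {G = G} (pair ab) (suc zero) zero eq = ⊥-elim (Adj⇒≢ G ab eq)
ordering-injective (pair ab) (suc zero) (suc zero) eq = refl
ordering-injective o zero zero eq = refl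
ordering-injective (add o _ new _) zero (suc j) eq = ⊥-elim (new (j , ≡-sym eq))
ordering-injective (add o _ new _) (suc i) zero eq = ⊥-elim (new (i , eq))
ordering-injective (add o _ _ _) (suc i) (suc j) eq = cong suc (ordering-injective o i j eq)

ordering-simplicial : {ℓ : Vec (Fin n) m} → Ordering G ℓ → ∀ {i j k} → i <ᶠ j → i <ᶠ k →
  Adj G (lookup ℓ i) (lookup ℓ j) → Adj G (lookup ℓ i) (lookup ℓ k) → lookup ℓ j ≢ lookup ℓ k →
  Adj G (lookup ℓ j) (lookup ℓ k)
ordering-simplicial (pair ab) {j = suc zero} {suc zero} _ _ _ _ ne = ⊥-elim (ne refl)
ordering-simplicial (add o _ _ simp) {zero} {suc j} {suc k} _ _ ij ik = simp _ _ (j , refl) (k , refl) ij ik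
ordering-simplicial (add o _ _ _) {suc i} {suc j} {suc k} (s≤s p) (s≤s q) = ordering-simplicial o p q

-- The positions beyond `i` form the prefix of size `m - 1 - i`; the bound says that this size is at
-- least two.
ordering-swappable : {ℓ : Vec (Fin n) m} → Ordering G ℓ → (i : Fin m) → 3 + toℕ i ≤ⁿ m →
                     Swappable G (λ v → ∃ λ j → i <ᶠ j × lookup ℓ j ≡ v)
ordering-swappable (pair _) i (s≤s (s≤s ()))
ordering-swappable (add o S _ _) zero le = swappable-resp
  (λ (j , eq) → suc j , s≤s z≤n , eq) (λ { (suc j , _ , eq) → j , eq }) S
ordering-swappable (add o _ _ _) (suc i) le = swappable-resp
  (λ (j , lt , eq) → suc j , s≤s lt , eq) (λ { (suc j , s≤s lt , eq) → j , lt , eq })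
  (ordering-swappable o i (ℕ.≤-pred le))

ordering-first-edge : {ℓ : Vec (Fin n) m} → Ordering G ℓ → ∃ λ i → ∃ λ j →
                      suc (toℕ i) ≡ m × suc (suc (toℕ j)) ≡ m × Adj G (lookup ℓ i) (lookup ℓ j)
ordering-first-edge (pair ab) = suc zero , zero , refl , refl , ab
ordering-first-edge (add o _ _ _) = let (i , j , p , q , ij) = ordering-first-edge o in
  suc i , suc j , cong suc p , cong suc q , ij

opposite-< : {i j : Fin n} → i <ᶠ j → opposite j <ᶠ opposite i
opposite-< {i = i} {j} lt = subst₂ _<ⁿ_ (≡-sym (opposite-prop j)) (≡-sym (opposite-prop i)) (ℕ.∸-monoʳ-< (s≤s lt) (toℕ<n j))

module _ (G : Graph n) (π : Permutation′ n) where

  private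
    injective : π ⟨$⟩ʳ u ≡ π ⟨$⟩ʳ v → u ≡ v
    injective eq = trans (≡-sym (inverseˡ π)) (trans (cong (π ⟨$⟩ˡ_) eq) (inverseˡ π))

  reach-relabel : (∀ {v} → W (π ⟨$⟩ʳ v) → W' v) → Reach G W (π ⟨$⟩ʳ u) (π ⟨$⟩ʳ v) → Reach (relabel G π) W' u v
  reach-relabel {W = W} {W' = W'} f r = go r refl refl
    where
    go : ∀ {x y u v} → Reach G W x y → x ≡ π ⟨$⟩ʳ u → y ≡ π ⟨$⟩ʳ v → Reach (relabel G π) W' u v
    go (here Wx) refl eq with injective eq
    ... | refl = here (f Wx)
    go (step Wx e r) refl eq = step (f Wx) (subst (Adj G _) (≡-sym (inverseʳ π)) e) (go r (≡-sym (inverseʳ π)) eq)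

  swappable-relabel : (∀ {v} → W (π ⟨$⟩ʳ v) → W' v) → (∀ {v} → W' v → W (π ⟨$⟩ʳ v)) →
                      Swappable G W → Swappable (relabel G π) W'
  swappable-relabel f g S = record
    { A = A ∘ (π ⟨$⟩ʳ_) ; B = B ∘ (π ⟨$⟩ʳ_) ; A? = A? ∘ (π ⟨$⟩ʳ_) ; B? = B? ∘ (π ⟨$⟩ʳ_) ; A⊆B = A⊆B ; B⊆W = f ∘ B⊆W
    ; apex = λ p q r s → injective (apex p q r s)
    ; two = let (a , b , Aa , Ab , a≢b) = two in
        π ⟨$⟩ˡ a , π ⟨$⟩ˡ b , subst A (≡-sym (inverseʳ π)) Aa , subst A (≡-sym (inverseʳ π)) Ab
        , λ eq → a≢b (trans (≡-sym (inverseʳ π)) (trans (cong (π ⟨$⟩ʳ_) eq) (inverseʳ π)))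
    ; A-conn = λ u v p q → reach-relabel id (A-conn _ _ p q)
    ; B-conn = λ u v p q → reach-relabel id (B-conn _ _ p q)
    ; A-cut = λ x Ax u v (p , u≢x) (q , v≢x) → reach-relabel (λ (r , ne) → r , ne ∘ cong (π ⟨$⟩ʳ_))
        (A-cut _ Ax _ _ (p , u≢x ∘ injective) (q , v≢x ∘ injective))
    ; B-cut = λ x Ax u v (p , u≢x) (q , v≢x) → reach-relabel (λ (r , ne) → r , ne ∘ cong (π ⟨$⟩ʳ_))
        (B-cut _ Ax _ _ (p , u≢x ∘ injective) (q , v≢x ∘ injective))
    ; closed = λ Au Wv e → closed Au (g Wv) e }
    where open Swappable S

theorem27 : ∀ {n} (G : Graph n) → Chordal G →
    Hyp G →
    Σ (Permutation′ n) λ π →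
    IsPEO (relabel G π)
    × (Σ (Forest n) λ F₀ → Σ (Forest n) λ F → Run (relabel G π) F₀ F)
    × (∀ F₀ F → Run (relabel G π) F₀ F →
    Σ (Fin n) λ p → Σ (Fin n) λ c → Rot (relabel G π) F₀ p c F)
-- The ordering has an a priori unknown length; it equals `n` because positions and vertices are in
-- bijection.
theorem27 {n} G chordal hyp = go ordering (λ v → covers _) (↔⇒≡ (perm ordering (λ v → covers _)))
  where
  open OrderingOf (hyp-ordering chordal hyp)

  module _ {m} {ℓ : Vec (Fin n) m} (o : Ordering G ℓ) (cov : ∀ v → Member ℓ v) where
    perm : Permutation m n
    -- The head of the vector comes last and must receive the largest label, so positions are
    -- reversed.
    perm = permutation (λ i → lookup ℓ (opposite i)) (λ v → opposite (proj₁ (cov v)))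
      (λ v → trans (cong (lookup ℓ) (opposite-involutive _)) (proj₂ (cov v)))
      (λ i → trans (cong opposite (ordering-injective o _ _ (proj₂ (cov _)))) (opposite-involutive i))

  go : ∀ {m} {ℓ : Vec (Fin n) m} → Ordering G ℓ → (∀ v → Member ℓ v) → m ≡ n → _
  go {ℓ = ℓ} o cov refl with ordering-first-edge o
  ... | i , j , i≡ , j≡ , ij = π , peo , rotation-run (relabel G π) peo {opposite i} {opposite j}
          (trans (opposite-prop i) (trans (cong (n ∸_) i≡) (ℕ.n∸n≡0 n)))
          (trans (opposite-prop j) (trans (cong (_∸ suc (toℕ j)) (≡-sym j≡)) (ℕ.m+n∸n≡m 1 (suc (toℕ j)))))
          (subst₂ (λ a b → Adj G (lookup ℓ a) (lookup ℓ b)) (≡-sym (opposite-involutive i)) (≡-sym (opposite-involutive j)) ij)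
          swappable
    where
    π : Permutation′ n
    π = perm o cov
    peo : IsPEO (relabel G π)
    peo v u w u<v w<v vu vw u≢w = ordering-simplicial o (opposite-< u<v) (opposite-< w<v) vu vw
      (λ eq → u≢w (trans (≡-sym (opposite-involutive u))
        (trans (cong opposite (ordering-injective o _ _ eq)) (opposite-involutive w))))
    swappable : ∀ k → 2 ≤ⁿ toℕ k → Swappable (relabel G π) (_<ᶠ k)
    swappable k le = swappable-relabel G π {W = λ v → ∃ λ j → opposite k <ᶠ j × lookup ℓ j ≡ v}
      (λ (j , lt , eq) → subst₂ _<ᶠ_ (trans (cong opposite (ordering-injective o _ _ eq)) (opposite-involutive _))
         (opposite-involutive k) (opposite-< lt))
      (λ {v} lt → opposite v , opposite-< lt , refl)
      (ordering-swappable o (opposite k) (subst (λ x → 3 + x ≤ⁿ n) (≡-sym (opposite-prop k)) bound))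
      where
      bound : 3 + (n ∸ suc (toℕ k)) ≤ⁿ n
      bound = ℕ.≤-trans (ℕ.+-monoˡ-≤ (n ∸ suc (toℕ k)) (s≤s le)) (ℕ.≤-reflexive (ℕ.m+[n∸m]≡n (toℕ<n k)))
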